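{- For all $k\ge 1$, $$I_{12\dots k}(x)=\frac{1}{x\,U_k\left(\frac{1}{2x}\right)}\sum_{j=0}^{k-1}U_j\left(\frac{1}{2x}\right),$$ where $I_{12\dots k}(x)=\sum_{n\ge 0}I_{12\dots k}(n)x^n$ and $I_{12\dots k}(n)$ is the number of involutions in $S_n$ avoiding both $132$ and $12\dots k$.
   Context: $S_n$ is the set of permutations of $\{1,\dots,n\}$. A permutation $\alpha\in S_n$ contains a pattern $\tau\in S_k$ if there are $1\le i_1<\dots<i_k\le n$ such that $(\alpha_{i_1},\dots,\alpha_{i_k})$ is order-isomorphic to $\tau$; otherwise $\alpha$ avoids $\tau$. An involution is a permutation equal to its own inverse; the empty permutation is counted for $n=0$. $U_r$ denotes the Chebyshev polynomial of the second kind, $U_r(\cos\theta)=\sin((r+1)\theta)/\sin\theta$. The identity is one of rational functions, expanded as power series in $x$. -}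

module Defs where

open import Algebra.Bundles using (CommutativeRing)
open import Algebra.Bundles.Raw using (RawRing)
open import Algebra.Definitions using (SelfInverse)
open import Data.Fin.Base using (Fin; toℕ; _<_)
open import Data.Fin.Patterns using (0F; 1F; 2F)
open import Data.Fin.Properties using (_≟_; _<?_; any?; all?)
open import Data.Integer.Base using (+_)
open import Data.List.Base as List using (List; cartesianProductWith; filter; length)
open import Data.List.Membership.Propositional using (_∈_; lose; find)
open import Data.List.Membership.Propositional.Properties
  using (∈-allFin; ∈-cartesianProductWith⁺)
open import Data.List.Relation.Unary.All as All using ()
open import Data.List.Relation.Unary.AllPairs as AllPairs using ()
import Data.List.Relation.Unary.Any as Any
open import Data.List.Relation.Unary.Unique.Propositional using (Unique)
import Data.List.Relation.Unary.Unique.Propositional.Properties as Unique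
open import Data.Nat.Base as ℕ using (ℕ; zero; suc; _∸_)
open import Data.Product.Base using (_×_; _,_; ∃-syntax)
open import Data.Rational.Base as ℚ using (ℚ; 0ℚ; 1ℚ; ½)
import Data.Rational.Properties as ℚ
open import Data.Vec.Base using (Vec; []; _∷_; lookup; map; allFin)
open import Data.Vec.Properties using (∷-injective)
open import Function.Bundles using (_⇔_; mk⇔; module Equivalence)
open import Function.Consequences.Propositional
  using (strictlySurjective⇒surjective; surjective⇒strictlySurjective)
open import Function.Definitions using (Bijective)
open import Level using (0ℓ)
open import Relation.Binary.Core using (_Preserves_⟶_)
open import Relation.Binary.PropositionalEquality using (_≡_; refl)
open import Relation.Nullary.Decidable using (Dec; map′; _×-dec_; _→-dec_; ¬?)
open import Relation.Nullary.Negation using (¬_)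
open import Relation.Unary using (Pred; Decidable)

import Algebra.Definitions.RawMonoid as RawMonoid

-- Permutations are written in one-line notation, with {1,…,n} replaced
-- by Fin n = {0,…,n-1}.

IsPermutation : ∀ {n} → Vec (Fin n) n → Set
IsPermutation α = Bijective _≡_ _≡_ (lookup α)

IsInvolution : ∀ {n} → Vec (Fin n) n → Set
IsInvolution α = IsPermutation α × SelfInverse _≡_ (lookup α)

OrderIsomorphic : ∀ {k m n} → Vec (Fin m) k → Vec (Fin n) k → Set
OrderIsomorphic σ τ =
  ∀ a b → (lookup σ a < lookup σ b) ⇔ (lookup τ a < lookup τ b)

-- ι lists the positions i₁ < … < iₖ of the occurrence.
Contains : ∀ {k n} → Vec (Fin k) k → Vec (Fin n) n → Set
Contains {k} {n} τ α = ∃[ ι ]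
  (lookup {n = k} ι Preserves _<_ ⟶ _<_) × OrderIsomorphic (map (lookup {n = n} α) ι) τ

Avoids : ∀ {k n} → Vec (Fin k) k → Vec (Fin n) n → Set
Avoids τ α = ¬ Contains τ α

pattern132 : Vec (Fin 3) 3
pattern132 = 0F ∷ 2F ∷ 1F ∷ []

increasing : ∀ k → Vec (Fin k) k
increasing = allFin

AvoidingInvolution : ∀ k {n} → Pred (Vec (Fin n) n) 0ℓ
AvoidingInvolution k α =
  IsInvolution α × Avoids pattern132 α × Avoids (increasing k) α

words : ∀ k n → List (Vec (Fin n) k)
words zero    n = [] List.∷ List.[]
words (suc k) n = cartesianProductWith _∷_ (List.allFin n) (words k n)

∈-words : ∀ {k n} (v : Vec (Fin n) k) → v ∈ words k n
∈-words []      = Any.here refl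
∈-words (x ∷ v) = ∈-cartesianProductWith⁺ _∷_ (∈-allFin x) (∈-words v)

words-unique : ∀ k n → Unique (words k n)
words-unique zero    n = All.[] AllPairs.∷ AllPairs.[]
words-unique (suc k) n =
  Unique.cartesianProductWith⁺ _∷_ ∷-injective (Unique.allFin⁺ n) (words-unique k n)

isPermutation? : ∀ {n} → Decidable (IsPermutation {n})
isPermutation? α =
  map′ (λ inj {i} {j} → inj i j) (λ inj i j → inj {i} {j})
    (all? λ i → all? λ j → (lookup α i ≟ lookup α j) →-dec (i ≟ j))
  ×-dec
  map′ strictlySurjective⇒surjective surjective⇒strictlySurjective
    (all? λ j → any? λ i → lookup α i ≟ j)

isInvolution? : ∀ {n} → Decidable (IsInvolution {n})
isInvolution? α = isPermutation? α ×-dec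
  map′ (λ inv {i} → λ { refl → inv i }) (λ inv i → inv refl)
    (all? λ i → lookup α (lookup α i) ≟ i)

contains? : ∀ {k n} (τ : Vec (Fin k) k) → Decidable (Contains {k} {n} τ)
contains? {k} {n} τ α =
  map′ (λ p → let ι , _ , q = find p in ι , q) (λ (ι , q) → lose (∈-words ι) q)
    (Any.any? occurrence? (words k n))
  where
  _⇔-dec_ : ∀ {A B : Set} → Dec A → Dec B → Dec (A ⇔ B)
  a? ⇔-dec b? = map′ (λ (f , g) → mk⇔ f g) (λ e → Equivalence.to e , Equivalence.from e)
    ((a? →-dec b?) ×-dec (b? →-dec a?))

  occurrence? : Decidable λ (ι : Vec (Fin n) k) →
    (lookup ι Preserves _<_ ⟶ _<_) × OrderIsomorphic (map (lookup α) ι) τ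
  occurrence? ι =
    map′ (λ inc {a} {b} → inc a b) (λ inc a b → inc {a} {b})
      (all? λ a → all? λ b → (a <? b) →-dec (lookup ι a <? lookup ι b))
    ×-dec
    (all? λ a → all? λ b →
      (lookup (map (lookup α) ι) a <? lookup (map (lookup α) ι) b)
      ⇔-dec (lookup τ a <? lookup τ b))

avoidingInvolution? : ∀ k {n} → Decidable (AvoidingInvolution k {n})
avoidingInvolution? k α =
  isInvolution? α ×-dec ¬? (contains? pattern132 α) ×-dec ¬? (contains? (increasing k) α)

numAvoidingInvolutions : ℕ → ℕ → ℕ
numAvoidingInvolutions k n = length (filter (avoidingInvolution? k) (words n n))

module Chebyshev {c ℓ} (R : RawRing c ℓ) where
  open RawRing R

  U : ℕ → Carrier → Carrier
  U zero          t = 1#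
  U (suc zero)    t = (1# + 1#) * t
  U (suc (suc r)) t = (1# + 1#) * t * U (suc r) t + - U r t

-- The recurrence agrees with U_r(cos θ) = sin((r+1)θ) / sin θ: below,
-- c and s stand for cos θ and sin θ, and cos(rθ), sin(rθ) are generated
-- by the addition formulas.
module Trigonometric {a ℓ} (R : CommutativeRing a ℓ) where
  open CommutativeRing R renaming (refl to ≈-refl; sym to ≈-sym) hiding (zero; trans)
  open Chebyshev rawRing
  open import Relation.Binary.Reasoning.Setoid setoid
  open import Algebra.Solver.Ring.NaturalCoefficients.Default commutativeSemiring
    using (solve; _:=_; _:+_; _:*_)
  open import Algebra.Properties.Ring ring using (-‿distribˡ-*)

  module _ (c s : Carrier) (c²+s²≈1 : c * c + s * s ≈ 1#) where

    cosMul sinMul : ℕ → Carrier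
    cosMul zero    = 1#
    cosMul (suc r) = cosMul r * c + - (sinMul r * s)
    sinMul zero    = 0#
    sinMul (suc r) = sinMul r * c + cosMul r * s

    sinMul-rec : ∀ r →
      sinMul (suc (suc r)) + sinMul r ≈ (1# + 1#) * c * sinMul (suc r)
    sinMul-rec r = begin
      (S * c + C * s) * c + (C * c + - (S * s)) * s + S
        ≈⟨ +-congˡ (*-identityʳ S) ⟨
      (S * c + C * s) * c + (C * c + - (S * s)) * s + S * 1#
        ≈⟨ +-congˡ (*-congˡ c²+s²≈1) ⟨
      (S * c + C * s) * c + (C * c + - (S * s)) * s + S * (c * c + s * s)
        ≈⟨ solve 5 (λ S C N c s →
             (S :* c :+ C :* s) :* c :+ (C :* c :+ N) :* s :+ S :* (c :* c :+ s :* s)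
             := c :* (S :* c :+ C :* s) :+ c :* (S :* c :+ C :* s) :+ (N :+ S :* s) :* s)
             ≈-refl S C (- (S * s)) c s ⟩
      c * S′ + c * S′ + (- (S * s) + S * s) * s
        ≈⟨ +-congˡ (*-congʳ (-‿inverseˡ (S * s))) ⟩
      c * S′ + c * S′ + 0# * s
        ≈⟨ +-congˡ (zeroˡ s) ⟩
      c * S′ + c * S′ + 0#
        ≈⟨ +-identityʳ _ ⟩
      c * S′ + c * S′
        ≈⟨ double (c * S′) ⟨
      (1# + 1#) * (c * S′)
        ≈⟨ *-assoc _ c S′ ⟨
      (1# + 1#) * c * S′ ∎
      where
      S  = sinMul r
      C  = cosMul r
      S′ = S * c + C * s

      double : ∀ x → (1# + 1#) * x ≈ x + x
      double x = begin
        (1# + 1#) * x    ≈⟨ distribʳ x 1# 1# ⟩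
        1# * x + 1# * x  ≈⟨ +-cong (*-identityˡ x) (*-identityˡ x) ⟩
        x + x            ∎

    U-sin : ∀ r → U r c * s ≈ sinMul (suc r)
    U-sin zero = begin
      1# * s           ≈⟨ +-identityˡ _ ⟨
      0# + 1# * s      ≈⟨ +-congʳ (zeroˡ c) ⟨
      0# * c + 1# * s  ∎
    U-sin (suc zero) = begin
      (1# + 1#) * c * s          ≈⟨ *-congˡ (*-identityˡ s) ⟨
      (1# + 1#) * c * (1# * s)   ≈⟨ *-congˡ (U-sin zero) ⟩
      (1# + 1#) * c * sinMul 1   ≈⟨ sinMul-rec 0 ⟨
      sinMul 2 + 0#              ≈⟨ +-identityʳ _ ⟩
      sinMul 2                   ∎
    U-sin (suc (suc r)) = begin
      (d * U (suc r) c + - U r c) * s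
        ≈⟨ distribʳ s _ _ ⟩
      d * U (suc r) c * s + - U r c * s
        ≈⟨ +-cong (*-assoc d _ s) (≈-sym (-‿distribˡ-* (U r c) s)) ⟩
      d * (U (suc r) c * s) + - (U r c * s)
        ≈⟨ +-cong (*-congˡ (U-sin (suc r))) (-‿cong (U-sin r)) ⟩
      d * sinMul (suc (suc r)) + - sinMul (suc r)
        ≈⟨ +-congʳ (sinMul-rec (suc r)) ⟨
      sinMul (suc (suc (suc r))) + sinMul (suc r) + - sinMul (suc r)
        ≈⟨ +-assoc _ _ _ ⟩
      sinMul (suc (suc (suc r))) + (sinMul (suc r) + - sinMul (suc r))
        ≈⟨ +-congˡ (-‿inverseʳ _) ⟩
      sinMul (suc (suc (suc r))) + 0#
        ≈⟨ +-identityʳ _ ⟩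
      sinMul (suc (suc (suc r))) ∎
      where
      d = (1# + 1#) * c

PowerSeries : Set
PowerSeries = ℕ → ℚ

-- Multiplication by xᵈ.
shift : ℕ → PowerSeries → PowerSeries
shift zero    f n       = f n
shift (suc d) f zero    = 0ℚ
shift (suc d) f (suc n) = shift d f n

constant : ℚ → PowerSeries
constant q zero    = q
constant q (suc n) = 0ℚ

infixl 7 _⊛_
_⊛_ : PowerSeries → PowerSeries → PowerSeries
(f ⊛ g) n = sum {suc n} λ i → f (toℕ i) ℚ.* g (n ∸ toℕ i)
  where open RawMonoid ℚ.+-0-rawMonoid using (sum)

infix 5 x⁻_·_
record LaurentSeries : Set where
  constructor x⁻_·_
  field
    poleBound : ℕ
    series    : PowerSeries

-- x⁻ᵈ f = x⁻ᵉ g is read as xᵉ f = xᵈ g, since the exponent in the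
-- representation need not be the exact order of the pole.
laurentRing : RawRing 0ℓ 0ℓ
laurentRing = record
  { Carrier = LaurentSeries
  ; _≈_     = λ (x⁻ d · f) (x⁻ e · g) → ∀ n → shift e f n ≡ shift d g n
  ; _+_     = λ (x⁻ d · f) (x⁻ e · g) → x⁻ (d ℕ.+ e) · λ n → shift e f n ℚ.+ shift d g n
  ; _*_     = λ (x⁻ d · f) (x⁻ e · g) → x⁻ (d ℕ.+ e) · (f ⊛ g)
  ; -_      = λ (x⁻ d · f) → x⁻ d · λ n → ℚ.- f n
  ; 0#      = x⁻ 0 · constant 0ℚ
  ; 1#      = x⁻ 0 · constant 1ℚ
  }

open RawRing laurentRing public
  using (_≈_; _*_; 1#; +-rawMonoid)
open RawMonoid +-rawMonoid public using (sum)
open Chebyshev laurentRing public using (U)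

X : LaurentSeries
X = x⁻ 0 · shift 1 (constant 1ℚ)

1/2X : LaurentSeries
1/2X = x⁻ 1 · constant ½

generatingFunction : (ℕ → ℕ) → LaurentSeries
generatingFunction a = x⁻ 0 · λ n → + a n ℚ./ 1

{-# OPTIONS --safe #-}
module Submission where

-- Let B(m,s) count the involutions of {0,…,m+s-1} that avoid 132 and 12…k
-- and increase on the last s positions; this is 0 for s ≥ k, since those
-- positions carry an increasing subsequence. If such an involution of
-- {0,…,m+s+1}, increasing from position m + 1 on, has a descent from m to
-- m + 1, then avoiding 132 forces it to exchange 0 and m + 1. Deleting this
-- 2-cycle is a bijection onto the involutions counted by B(m,s). Hence
-- B(m+1,s+1) = B(m,s+2) + B(m,s) and B(m+1,0) = B(m,1): B(m,s) is the number
-- of walks with m steps ±1 that start at s and stay in {0,…,k-1}.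
--
-- The series F_s = Σ_m B(m,s) x^m satisfy F_s = 1 + x F_{s+1} + x F_{s-1} with
-- F_{-1} = F_k = 0. Solved upwards from F_0 this is the recurrence of the U_s,
-- and gives F_0 · x U_k = U_0 + … + U_{k-1}. With the source 1 replaced by
-- the indicator of s = k - 1 it gives G_0 · x U_k = 1.

open import Defs hiding (_≈_; _*_; 1#; +-rawMonoid; sum; U)
open import Algebra.Bundles using (CommutativeRing)
open import Algebra.Bundles.Raw using (RawRing)
open import Data.Fin.Base as Fin
  using (Fin; zero; suc; toℕ; _<_; punchIn; punchOut; inject₁; inject≤; fromℕ; _↑ˡ_; _↑ʳ_)
open import Data.Fin.Patterns using (0F; 1F; 2F)
import Data.Fin.Properties as Fin
import Data.Integer.Base as ℤ
import Data.Integer.Properties as ℤ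
open import Data.List.Base as List using (List; length)
open import Data.List.Membership.Propositional using (_∈_)
open import Data.List.Membership.Propositional.Properties
  using (∈-++⁺ˡ; ∈-++⁺ʳ; ∈-++⁻; ∈-map⁺; ∈-map⁻; ∈-filter⁺; ∈-filter⁻)
open import Data.List.Membership.Propositional.Properties.WithK using (unique∧set⇒bag)
import Data.List.Properties as List
open import Data.List.Relation.Binary.BagAndSetEquality using (∼bag⇒↭)
open import Data.List.Relation.Binary.Permutation.Propositional.Properties using (↭-length)
open import Data.List.Relation.Unary.All as All using ()
open import Data.List.Relation.Unary.AllPairs as AllPairs using ()
open import Data.List.Relation.Unary.Any using (here)
open import Data.List.Relation.Unary.Unique.Propositional using (Unique)
import Data.List.Relation.Unary.Unique.Propositional.Properties as Unique
open import Data.Nat.Base as ℕ using (ℕ; zero; suc; _≥_; z≤n; s≤s; z<s; s<s)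
import Data.Nat.Properties as ℕ
open import Data.Product.Base using (_×_; _,_; ∃-syntax; Σ-syntax; proj₁; proj₂)
open import Data.Rational.Base as ℚ using (ℚ; 0ℚ; 1ℚ; ½)
import Data.Rational.Properties as ℚ
open import Data.Rational.Solver using (module +-*-Solver)
open import Data.Rational.Unnormalised.Base as ℚᵘ using (mkℚᵘ; *≡*)
import Data.Rational.Unnormalised.Properties as ℚᵘ
open import Data.Sum.Base using (inj₁; inj₂)
open import Data.Vec.Base using (Vec; []; _∷_; lookup; map; allFin; tabulate; insertAt)
open import Data.Vec.Properties
  using (lookup-map; lookup-allFin; lookup∘tabulate; tabulate∘lookup; tabulate-cong;
         insertAt-lookup; insertAt-punchIn)
open import Function.Base using (_∘_; id)
open import Function.Bundles using (mk⇔; module Equivalence)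
open import Function.Consequences.Propositional using (strictlySurjective⇒surjective)
open import Level using (0ℓ)
open import Relation.Binary.Core using (_Preserves_⟶_)
open import Relation.Binary.Definitions using (tri<; tri≈; tri>)
open import Relation.Binary.PropositionalEquality
  using (_≡_; _≢_; refl; sym; trans; cong; cong₂; subst; subst₂; module ≡-Reasoning)
open import Relation.Nullary.Decidable using (yes; no)
open import Relation.Nullary.Negation using (¬_; contradiction)

-- Tridiagonal linear systems and Chebyshev polynomials

module TridiagonalSystem {c ℓ} (R : CommutativeRing c ℓ) where
  open CommutativeRing R renaming (refl to ≈-refl; sym to ≈-sym; trans to ≈-trans) hiding (zero)
  open import Algebra.Definitions.RawMonoid +-rawMonoid using () renaming (sum to ∑)
  open Chebyshev rawRing renaming (U to Uᴿ)
  open import Algebra.Properties.Ring ring using (-‿distribʳ-*; -0#≈0#)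
  open import Algebra.Properties.AbelianGroup +-abelianGroup using (⁻¹-∙-comm)
  open import Algebra.Properties.CommutativeMonoid.Sum +-commutativeMonoid
    using (∑-distrib-+)
  open import Algebra.Properties.Semiring.Sum semiring using (*-distribˡ-sum)
  open import Algebra.Solver.Ring.NaturalCoefficients.Default commutativeSemiring
    using (solve; _:=_; _:+_; _:*_; con)
  open import Relation.Binary.Reasoning.Setoid setoid

  module _ (x t : Carrier) (x*2t≈1 : x * ((1# + 1#) * t) ≈ 1#) where

    private
      d : Carrier
      d = (1# + 1#) * t

    -- Without a source, F s = F 0 · U_s; T s corrects for the source.
    module _ (K : ℕ) (F source T : ℕ → Carrier)
      (F-zero : 0 ℕ.< K → F 0 ≈ source 0 + x * F 1)
      (F-suc  : ∀ s → suc s ℕ.< K → F (suc s) ≈ source (suc s) + (x * F (suc (suc s)) + x * F s))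
      (T-zero : T 0 ≈ 0#)
      (T-one  : 0 ℕ.< K → T 1 ≈ source 0)
      (T-suc  : ∀ s → suc s ℕ.< K → T (suc (suc s)) ≈ source (suc s) + (d * T (suc s) + - T s))
      where

      -- Two-step induction along the Chebyshev recurrence. Since d · x = 1, the term d · x · F (s +
      -- 1) is F (s + 1). Its equation expands it, x · F s cancels, and the source goes into T (s +
      -- 2).
      F₀*xU : ∀ s → s ℕ.≤ K → F 0 * (x * Uᴿ s t) ≈ T s + x * F s
      F₀*xU zero _ = begin
        F 0 * (x * 1#)  ≈⟨ *-congˡ (*-identityʳ x) ⟩
        F 0 * x         ≈⟨ *-comm (F 0) x ⟩
        x * F 0         ≈⟨ +-identityˡ _ ⟨
        0# + x * F 0    ≈⟨ +-congʳ T-zero ⟨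
        T 0 + x * F 0   ∎
      F₀*xU (suc zero) 0<K = begin
        F 0 * (x * d)        ≈⟨ *-congˡ x*2t≈1 ⟩
        F 0 * 1#             ≈⟨ *-identityʳ (F 0) ⟩
        F 0                  ≈⟨ F-zero 0<K ⟩
        source 0 + x * F 1   ≈⟨ +-congʳ (T-one 0<K) ⟨
        T 1 + x * F 1        ∎
      F₀*xU (suc (suc s)) s+1<K = begin
        F 0 * (x * (d * U₁ + - U₀))
          -- Negated terms enter as independent variables, so only a semiring identity remains.
          ≈⟨ solve 5 (λ f x d u n → f :* (x :* (d :* u :+ n)) := d :* (f :* (x :* u)) :+ f :* x :* n)
               ≈-refl (F 0) x d U₁ (- U₀) ⟩
        d * (F 0 * (x * U₁)) + F 0 * x * - U₀
          ≈⟨ +-congˡ (-‿distribʳ-* (F 0 * x) U₀) ⟨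
        d * (F 0 * (x * U₁)) + - (F 0 * x * U₀)
          ≈⟨ +-cong (*-congˡ (F₀*xU (suc s) s+1≤K))
                    (-‿cong (≈-trans (*-assoc (F 0) x U₀) (F₀*xU s s≤K))) ⟩
        d * (T (suc s) + x * F (suc s)) + - (T s + x * F s)
          ≈⟨ +-congˡ (⁻¹-∙-comm (T s) (x * F s)) ⟨
        d * (T (suc s) + x * F (suc s)) + (- T s + - (x * F s))
          ≈⟨ solve 6 (λ d T₁ x F₁ n m → d :* (T₁ :+ x :* F₁) :+ (n :+ m)
                       := (d :* T₁ :+ n) :+ (x :* d :* F₁ :+ m))
               ≈-refl d (T (suc s)) x (F (suc s)) (- T s) (- (x * F s)) ⟩
        (d * T (suc s) + - T s) + (x * d * F (suc s) + - (x * F s))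
          ≈⟨ +-congˡ (+-congʳ (≈-trans (*-congʳ x*2t≈1) (≈-trans (*-identityˡ _) (F-suc s s+1<K)))) ⟩
        (d * T (suc s) + - T s) + (source (suc s) + (x * F (suc (suc s)) + x * F s) + - (x * F s))
          ≈⟨ solve 5 (λ a c p q m → a :+ (c :+ (p :+ q) :+ m) := c :+ a :+ p :+ (q :+ m))
               ≈-refl (d * T (suc s) + - T s) (source (suc s)) (x * F (suc (suc s))) (x * F s) (- (x * F s)) ⟩
        source (suc s) + (d * T (suc s) + - T s) + x * F (suc (suc s)) + (x * F s + - (x * F s))
          ≈⟨ +-congˡ (-‿inverseʳ (x * F s)) ⟩
        source (suc s) + (d * T (suc s) + - T s) + x * F (suc (suc s)) + 0#
          ≈⟨ +-identityʳ _ ⟩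
        source (suc s) + (d * T (suc s) + - T s) + x * F (suc (suc s))
          ≈⟨ +-congʳ (T-suc s s+1<K) ⟨
        T (suc (suc s)) + x * F (suc (suc s)) ∎
        where
        U₁ = Uᴿ (suc s) t
        U₀ = Uᴿ s t
        s+1≤K = ℕ.<⇒≤ s+1<K
        s≤K = ℕ.<⇒≤ s+1≤K

      F₀*xU-boundary : F K ≈ 0# → F 0 * (x * Uᴿ K t) ≈ T K
      F₀*xU-boundary FK≈0 = begin
        F 0 * (x * Uᴿ K t)  ≈⟨ F₀*xU K ℕ.≤-refl ⟩
        T K + x * F K       ≈⟨ +-congˡ (≈-trans (*-congˡ FK≈0) (zeroʳ x)) ⟩
        T K + 0#            ≈⟨ +-identityʳ (T K) ⟩
        T K                 ∎

    ∑U : ℕ → Carrier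
    ∑U s = ∑ {s} λ j → Uᴿ (toℕ j) t

    ∑-neg : ∀ n (f : Fin n → Carrier) → ∑ (λ j → - f j) ≈ - ∑ f
    ∑-neg zero    f = ≈-sym -0#≈0#
    ∑-neg (suc n) f = ≈-trans (+-congˡ (∑-neg n _)) (⁻¹-∙-comm _ _)

    -- This is the recurrence required of T for the source 1. The summands U_0 = 1 and U_1 = d are
    -- split off, and the Chebyshev recurrence is summed over the rest.
    ∑U-suc : ∀ s → ∑U (suc (suc s)) ≈ 1# + (d * ∑U (suc s) + - ∑U s)
    ∑U-suc s = +-congˡ (begin
      d + ∑ {s} (λ j → d * Uᴿ (suc (toℕ j)) t + - Uᴿ (toℕ j) t)
        ≈⟨ +-congˡ (∑-distrib-+ {s} _ _) ⟩
      d + (∑ {s} (λ j → d * Uᴿ (suc (toℕ j)) t) + ∑ {s} (λ j → - Uᴿ (toℕ j) t))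
        ≈⟨ +-congˡ (+-cong (*-distribˡ-sum {s} d _) (≈-sym (∑-neg s _))) ⟨
      d + (d * ∑ {s} (λ j → Uᴿ (suc (toℕ j)) t) + - ∑U s)
        ≈⟨ solve 3 (λ d a n → d :+ (d :* a :+ n) := d :* (con 1 :+ a) :+ n) ≈-refl d _ _ ⟩
      d * (1# + ∑ {s} (λ j → Uᴿ (suc (toℕ j)) t)) + - ∑U s ∎)

  -- Serves the source concentrated at the top, where both earlier values of the correction vanish.
  +-zeroes : ∀ a b c d → a ≈ 0# → b ≈ 0# → c + (d * a + - b) ≈ c
  +-zeroes a b c d a≈0 b≈0 = begin
    c + (d * a + - b)  ≈⟨ +-congˡ (+-cong (≈-trans (*-congˡ a≈0) (zeroʳ d)) (≈-trans (-‿cong b≈0) -0#≈0#)) ⟩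
    c + (0# + 0#)      ≈⟨ +-congˡ (+-identityʳ 0#) ⟩
    c + 0#             ≈⟨ +-identityʳ c ⟩
    c                  ∎

  divide : ∀ a b c y → y * b ≈ 1# → a * b ≈ c → a ≈ y * c
  divide a b c y yb≈1 ab≈c = begin
    a            ≈⟨ *-identityˡ a ⟨
    1# * a       ≈⟨ *-congʳ yb≈1 ⟨
    y * b * a    ≈⟨ *-assoc y b a ⟩
    y * (b * a)  ≈⟨ *-congˡ (*-comm b a) ⟩
    y * (a * b)  ≈⟨ *-congˡ ab≈c ⟩
    y * c        ∎

-- The ring of Laurent series

infix 4 _≐_
_≐_ : PowerSeries → PowerSeries → Set
f ≐ g = ∀ n → f n ≡ g n

infixl 6 _⊞_
_⊞_ : PowerSeries → PowerSeries → PowerSeries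
(f ⊞ g) n = f n ℚ.+ g n

⊟_ : PowerSeries → PowerSeries
(⊟ f) n = ℚ.- f n

tail : PowerSeries → PowerSeries
tail f n = f (suc n)

-- Formal power series under the Cauchy product

module PowerSeriesLaws where
  open import Data.Rational.Base using (_+_; _*_; -_)
  open +-*-Solver
  open ≡-Reasoning

  -- `(f ⊛ g) (suc n)` unfolds to `f 0 * g (suc n) + (tail f ⊛ g) n`, and `(f ⊛ g) 0` to
  -- `f 0 * g 0 + 0ℚ`. Most laws below therefore go by induction on n with f replaced by its tail.
  ⊛-cong : ∀ {f f′ g g′} → f ≐ f′ → g ≐ g′ → f ⊛ g ≐ f′ ⊛ g′
  ⊛-cong p q zero    = cong (_+ 0ℚ) (cong₂ _*_ (p 0) (q 0))
  ⊛-cong p q (suc n) = cong₂ _+_ (cong₂ _*_ (p 0) (q (suc n))) (⊛-cong (p ∘ suc) q n)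

  scale-⊛ : ∀ a f g n → ((λ i → a * f i) ⊛ g) n ≡ a * (f ⊛ g) n
  scale-⊛ a f g zero    = solve 3 (λ a x y → (a :* x) :* y :+ con 0ℚ := a :* (x :* y :+ con 0ℚ)) refl a (f 0) (g 0)
  scale-⊛ a f g (suc n) = begin
    a * f 0 * g (suc n) + ((λ i → a * f (suc i)) ⊛ g) n  ≡⟨ cong (a * f 0 * g (suc n) +_) (scale-⊛ a (tail f) g n) ⟩
    a * f 0 * g (suc n) + a * (tail f ⊛ g) n             ≡⟨ solve 4 (λ a x y z → (a :* x) :* y :+ a :* z := a :* (x :* y :+ z)) refl a (f 0) (g (suc n)) _ ⟩
    a * (f 0 * g (suc n) + (tail f ⊛ g) n)               ∎

  ⊛-distribʳ-⊞ : ∀ h f g → (f ⊞ g) ⊛ h ≐ f ⊛ h ⊞ g ⊛ h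
  ⊛-distribʳ-⊞ h f g zero    = solve 3 (λ x y z → (x :+ y) :* z :+ con 0ℚ := (x :* z :+ con 0ℚ) :+ (y :* z :+ con 0ℚ)) refl (f 0) (g 0) (h 0)
  ⊛-distribʳ-⊞ h f g (suc n) = begin
    (f 0 + g 0) * h (suc n) + ((tail f ⊞ tail g) ⊛ h) n
      ≡⟨ cong ((f 0 + g 0) * h (suc n) +_) (⊛-distribʳ-⊞ h (tail f) (tail g) n) ⟩
    (f 0 + g 0) * h (suc n) + ((tail f ⊛ h) n + (tail g ⊛ h) n)
      ≡⟨ solve 5 (λ x y z u v → (x :+ y) :* z :+ (u :+ v) := (x :* z :+ u) :+ (y :* z :+ v)) refl (f 0) (g 0) (h (suc n)) _ _ ⟩
    (f 0 * h (suc n) + (tail f ⊛ h) n) + (g 0 * h (suc n) + (tail g ⊛ h) n) ∎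

  ⊛-assoc : ∀ f g h → (f ⊛ g) ⊛ h ≐ f ⊛ (g ⊛ h)
  ⊛-assoc f g h zero    = solve 3 (λ x y z → (x :* y :+ con 0ℚ) :* z :+ con 0ℚ := x :* (y :* z :+ con 0ℚ) :+ con 0ℚ) refl (f 0) (g 0) (h 0)
  ⊛-assoc f g h (suc n) = begin
    -- The tail of `f ⊛ g` is by definition f 0 · `tail g` plus `tail f ⊛ g`.
    (f 0 * g 0 + 0ℚ) * h (suc n) + (((λ i → f 0 * g (suc i)) ⊞ tail f ⊛ g) ⊛ h) n
      ≡⟨ cong ((f 0 * g 0 + 0ℚ) * h (suc n) +_)
           (trans (⊛-distribʳ-⊞ h (λ i → f 0 * g (suc i)) (tail f ⊛ g) n)
                  (cong₂ _+_ (scale-⊛ (f 0) (tail g) h n) (⊛-assoc (tail f) g h n))) ⟩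
    (f 0 * g 0 + 0ℚ) * h (suc n) + (f 0 * (tail g ⊛ h) n + (tail f ⊛ (g ⊛ h)) n)
      ≡⟨ solve 5 (λ x y z u v → (x :* y :+ con 0ℚ) :* z :+ (x :* u :+ v) := x :* (y :* z :+ u) :+ v) refl (f 0) (g 0) (h (suc n)) _ _ ⟩
    f 0 * (g 0 * h (suc n) + (tail g ⊛ h) n) + (tail f ⊛ (g ⊛ h)) n ∎

  -- Splits off the last summand, where the definition splits off the first. Playing the two against
  -- each other gives commutativity.
  ⊛-unfoldʳ : ∀ f g n → (f ⊛ g) (suc n) ≡ f (suc n) * g 0 + (f ⊛ tail g) n
  ⊛-unfoldʳ f g zero    = solve 4 (λ x y u v → x :* v :+ (y :* u :+ con 0ℚ) := y :* u :+ (x :* v :+ con 0ℚ)) refl (f 0) (f 1) (g 0) (g 1)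
  ⊛-unfoldʳ f g (suc n) = begin
    f 0 * g (2 ℕ.+ n) + (tail f ⊛ g) (suc n)
      ≡⟨ cong (f 0 * g (2 ℕ.+ n) +_) (⊛-unfoldʳ (tail f) g n) ⟩
    f 0 * g (2 ℕ.+ n) + (f (2 ℕ.+ n) * g 0 + (tail f ⊛ tail g) n)
      ≡⟨ solve 3 (λ x y z → x :+ (y :+ z) := y :+ (x :+ z)) refl (f 0 * g (2 ℕ.+ n)) (f (2 ℕ.+ n) * g 0) _ ⟩
    f (2 ℕ.+ n) * g 0 + (f 0 * g (2 ℕ.+ n) + (tail f ⊛ tail g) n) ∎

  ⊛-comm : ∀ f g → f ⊛ g ≐ g ⊛ f
  ⊛-comm f g zero    = cong (_+ 0ℚ) (ℚ.*-comm (f 0) (g 0))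
  ⊛-comm f g (suc n) = begin
    f 0 * g (suc n) + (tail f ⊛ g) n  ≡⟨ cong₂ _+_ (ℚ.*-comm (f 0) (g (suc n))) (⊛-comm (tail f) g n) ⟩
    g (suc n) * f 0 + (g ⊛ tail f) n  ≡⟨ ⊛-unfoldʳ g f n ⟨
    (g ⊛ f) (suc n)                   ∎

  zero-⊛ : ∀ g n → ((λ _ → 0ℚ) ⊛ g) n ≡ 0ℚ
  zero-⊛ g zero    = trans (ℚ.+-identityʳ _) (ℚ.*-zeroˡ (g 0))
  zero-⊛ g (suc n) = cong₂ _+_ (ℚ.*-zeroˡ (g (suc n))) (zero-⊛ g n)

  constant-⊛ : ∀ q g n → (constant q ⊛ g) n ≡ q * g n
  constant-⊛ q g zero    = ℚ.+-identityʳ _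
  constant-⊛ q g (suc n) = trans (cong (q * g (suc n) +_) (zero-⊛ g n)) (ℚ.+-identityʳ _)

  ⊛-identityˡ : ∀ g → constant 1ℚ ⊛ g ≐ g
  ⊛-identityˡ g n = trans (constant-⊛ 1ℚ g n) (ℚ.*-identityˡ (g n))

  constant-0 : constant 0ℚ ≐ λ _ → 0ℚ
  constant-0 zero    = refl
  constant-0 (suc n) = refl

  powerSeriesRing : CommutativeRing 0ℓ 0ℓ
  powerSeriesRing = record
    { Carrier = PowerSeries
    ; _≈_     = _≐_
    ; _+_     = _⊞_
    ; _*_     = _⊛_
    ; -_      = ⊟_
    ; 0#      = constant 0ℚ
    ; 1#      = constant 1ℚ
    ; isCommutativeRing = record
      { isRing = record
        { +-isAbelianGroup = record
          { isGroup = record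
            { isMonoid = record
              { isSemigroup = record
                { isMagma = record
                  { isEquivalence = record
                    { refl  = λ _ → refl
                    ; sym   = λ p n → sym (p n)
                    ; trans = λ p q n → trans (p n) (q n)
                    }
                  ; ∙-cong = λ p q n → cong₂ _+_ (p n) (q n)
                  }
                ; assoc = λ f g h n → ℚ.+-assoc (f n) (g n) (h n)
                }
              ; identity = (λ f n → trans (cong (_+ f n) (constant-0 n)) (ℚ.+-identityˡ (f n)))
                         , (λ f n → trans (cong (f n +_) (constant-0 n)) (ℚ.+-identityʳ (f n)))
              }
            ; inverse = (λ f n → trans (ℚ.+-inverseˡ (f n)) (sym (constant-0 n)))
                      , (λ f n → trans (ℚ.+-inverseʳ (f n)) (sym (constant-0 n)))
            ; ⁻¹-cong = λ p n → cong -_ (p n)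
            }
          ; comm = λ f g n → ℚ.+-comm (f n) (g n)
          }
        ; *-cong     = ⊛-cong
        ; *-assoc    = ⊛-assoc
        ; *-identity = ⊛-identityˡ , (λ f n → trans (⊛-comm f (constant 1ℚ) n) (⊛-identityˡ f n))
        ; distrib    = (λ h f g n → trans (⊛-comm h (f ⊞ g) n)
                          (trans (⊛-distribʳ-⊞ h f g n) (cong₂ _+_ (⊛-comm f h n) (⊛-comm g h n))))
                     , ⊛-distribʳ-⊞
        }
      ; *-comm = ⊛-comm
      }
    }

open PowerSeriesLaws

-- Powers of x and shifts

xPow : ℕ → PowerSeries
xPow d = shift d (constant 1ℚ)

-- Turns shifts into products, so that statements about pole bounds become ring identities.
shift-⊛ : ∀ d f → shift d f ≐ xPow d ⊛ f
shift-⊛ zero    f n       = sym (⊛-identityˡ f n)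
shift-⊛ (suc d) f zero    = sym (trans (ℚ.+-identityʳ _) (ℚ.*-zeroˡ (f 0)))
shift-⊛ (suc d) f (suc n) =
  trans (shift-⊛ d f n) (sym (trans (cong (ℚ._+ (xPow d ⊛ f) n) (ℚ.*-zeroˡ (f (suc n)))) (ℚ.+-identityˡ _)))

shift-+ : ∀ d e f → shift (d ℕ.+ e) f ≐ shift d (shift e f)
shift-+ zero    e f n       = refl
shift-+ (suc d) e f zero    = refl
shift-+ (suc d) e f (suc n) = shift-+ d e f n

xPow-+ : ∀ d e → xPow (d ℕ.+ e) ≐ xPow d ⊛ xPow e
xPow-+ d e n = trans (shift-+ d e (constant 1ℚ) n) (shift-⊛ d (xPow e) n)

-- Powers of x are cancellable. This is what makes the cross-multiplied equality of Laurent series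
-- transitive.
shift-cancel : ∀ d {f g} → shift d f ≐ shift d g → f ≐ g
shift-cancel zero    p n = p n
shift-cancel (suc d) p n = shift-cancel d (p ∘ suc) n

-- Laurent series as fractions whose denominators are powers of x

module LaurentLaws where
  open CommutativeRing powerSeriesRing
    using (setoid; ring; commutativeSemiring; +-cong; +-congʳ; *-cong; *-congˡ; -‿cong; -‿inverseˡ)
    renaming (refl to ≐-refl; sym to ≐-sym; trans to ≐-trans)
  open import Algebra.Solver.Ring.NaturalCoefficients.Default commutativeSemiring
    using (solve; _:=_; _:+_; _:*_; con)
  open import Relation.Binary.Reasoning.Setoid setoid
  open import Algebra.Properties.Ring ring using (-‿distribʳ-*)
  open RawRing laurentRing using () renaming
    (_≈_ to _≃_; _+_ to _⊕_; _*_ to _⊗_; -_ to ⊖_; 0# to 0ᴸ; 1# to 1ᴸ)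
  open LaurentSeries

  -- a is the fraction s / P, where P is a power of x. This turns the laws
  -- of Laurent series into semiring identities of power series.
  record Fraction (a : LaurentSeries) (P s : PowerSeries) : Set where
    constructor fraction
    field
      denominator : xPow (poleBound a) ≐ P
      numerator   : series a ≐ s

  -- Equality by cross-multiplication. With P and Q free, the denominator of a sum or product can be
  -- presented as a product of the given denominators.
  fraction-≃ : ∀ {a b P Q s t} → Fraction a P s → Fraction b Q t → Q ⊛ s ≐ P ⊛ t → a ≃ b
  fraction-≃ {x⁻ d · f} {x⁻ e · g} {P} {Q} {s} {t} (fraction p p′) (fraction q q′) Qs≐Pt = begin
    shift e f   ≈⟨ shift-⊛ e f ⟩
    xPow e ⊛ f  ≈⟨ ⊛-cong q p′ ⟩
    Q ⊛ s       ≈⟨ Qs≐Pt ⟩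
    P ⊛ t       ≈⟨ ⊛-cong p q′ ⟨
    xPow d ⊛ g  ≈⟨ shift-⊛ d g ⟨
    shift d g   ∎

  ≃-cross : ∀ a b → a ≃ b → xPow (poleBound b) ⊛ series a ≐ xPow (poleBound a) ⊛ series b
  ≃-cross (x⁻ d · f) (x⁻ e · g) p = begin
    xPow e ⊛ f  ≈⟨ shift-⊛ e f ⟨
    shift e f   ≈⟨ p ⟩
    shift d g   ≈⟨ shift-⊛ d g ⟩
    xPow d ⊛ g  ∎

  atom : ∀ a → Fraction a (xPow (poleBound a)) (series a)
  atom a = fraction ≐-refl ≐-refl

  0ᶠ : Fraction 0ᴸ (constant 1ℚ) (constant 0ℚ)
  0ᶠ = fraction ≐-refl ≐-refl

  1ᶠ : Fraction 1ᴸ (constant 1ℚ) (constant 1ℚ)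
  1ᶠ = fraction ≐-refl ≐-refl

  infixl 6 _⊕ᶠ_
  _⊕ᶠ_ : ∀ {a b P Q s t} → Fraction a P s → Fraction b Q t →
         Fraction (a ⊕ b) (P ⊛ Q) (Q ⊛ s ⊞ P ⊛ t)
  _⊕ᶠ_ {x⁻ d · f} {x⁻ e · g} (fraction p p′) (fraction q q′) = fraction
    (≐-trans (xPow-+ d e) (⊛-cong p q))
    (+-cong (≐-trans (shift-⊛ e f) (⊛-cong q p′)) (≐-trans (shift-⊛ d g) (⊛-cong p q′)))

  infixl 7 _⊗ᶠ_
  _⊗ᶠ_ : ∀ {a b P Q s t} → Fraction a P s → Fraction b Q t →
         Fraction (a ⊗ b) (P ⊛ Q) (s ⊛ t)
  _⊗ᶠ_ {x⁻ d · f} {x⁻ e · g} (fraction p p′) (fraction q q′) =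
    fraction (≐-trans (xPow-+ d e) (⊛-cong p q)) (⊛-cong p′ q′)

  ⊖ᶠ_ : ∀ {a P s} → Fraction a P s → Fraction (⊖ a) P (⊟ s)
  ⊖ᶠ_ {x⁻ d · f} (fraction p p′) = fraction p (-‿cong p′)

  ≃-sym : ∀ a b → a ≃ b → b ≃ a
  ≃-sym _ _ p n = sym (p n)

  ≃-trans : ∀ a b c → a ≃ b → b ≃ c → a ≃ c
  -- Both hypotheses apply after multiplication by the middle denominator, which is then cancelled.
  ≃-trans a@(x⁻ d · f) b@(x⁻ e · g) c@(x⁻ h · k) p q = shift-cancel e (begin
    shift e (shift h f)    ≈⟨ shift²-⊛ e h f ⟩
    E ⊛ (H ⊛ f)            ≈⟨ solve 3 (λ E H f → E :* (H :* f) := H :* (E :* f)) ≐-refl E H f ⟩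
    H ⊛ (E ⊛ f)            ≈⟨ *-congˡ {H} (≃-cross a b p) ⟩
    H ⊛ (D ⊛ g)            ≈⟨ solve 3 (λ H D g → H :* (D :* g) := D :* (H :* g)) ≐-refl H D g ⟩
    D ⊛ (H ⊛ g)            ≈⟨ *-congˡ {D} (≃-cross b c q) ⟩
    D ⊛ (E ⊛ k)            ≈⟨ solve 3 (λ D E k → D :* (E :* k) := E :* (D :* k)) ≐-refl D E k ⟩
    E ⊛ (D ⊛ k)            ≈⟨ shift²-⊛ e d k ⟨
    shift e (shift d k)    ∎)
    where
    D = xPow d
    E = xPow e
    H = xPow h
    shift²-⊛ : ∀ i j u → shift i (shift j u) ≐ xPow i ⊛ (xPow j ⊛ u)
    shift²-⊛ i j u = ≐-trans (shift-⊛ i (shift j u)) (*-congˡ {xPow i} (shift-⊛ j u))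

  ⊕-cong : ∀ a a′ b b′ → a ≃ a′ → b ≃ b′ → a ⊕ b ≃ a′ ⊕ b′
  ⊕-cong a@(x⁻ d · f) a′@(x⁻ d′ · f′) b@(x⁻ e · g) b′@(x⁻ e′ · g′) p q =
    fraction-≃ (atom a ⊕ᶠ atom b) (atom a′ ⊕ᶠ atom b′) (begin
      D′ ⊛ E′ ⊛ (E ⊛ f ⊞ D ⊛ g)
        ≈⟨ solve 6 (λ D D′ E E′ f g → D′ :* E′ :* (E :* f :+ D :* g)
             := E′ :* E :* (D′ :* f) :+ D′ :* D :* (E′ :* g)) ≐-refl D D′ E E′ f g ⟩
      E′ ⊛ E ⊛ (D′ ⊛ f) ⊞ D′ ⊛ D ⊛ (E′ ⊛ g)
        ≈⟨ +-cong (*-congˡ {E′ ⊛ E} (≃-cross a a′ p)) (*-congˡ {D′ ⊛ D} (≃-cross b b′ q)) ⟩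
      E′ ⊛ E ⊛ (D ⊛ f′) ⊞ D′ ⊛ D ⊛ (E ⊛ g′)
        ≈⟨ solve 6 (λ D D′ E E′ f g → E′ :* E :* (D :* f) :+ D′ :* D :* (E :* g)
             := D :* E :* (E′ :* f :+ D′ :* g)) ≐-refl D D′ E E′ f′ g′ ⟩
      D ⊛ E ⊛ (E′ ⊛ f′ ⊞ D′ ⊛ g′) ∎)
    where
    D = xPow d
    D′ = xPow d′
    E = xPow e
    E′ = xPow e′

  ⊗-cong : ∀ a a′ b b′ → a ≃ a′ → b ≃ b′ → a ⊗ b ≃ a′ ⊗ b′
  ⊗-cong a@(x⁻ d · f) a′@(x⁻ d′ · f′) b@(x⁻ e · g) b′@(x⁻ e′ · g′) p q =
    fraction-≃ (atom a ⊗ᶠ atom b) (atom a′ ⊗ᶠ atom b′) (begin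
      D′ ⊛ E′ ⊛ (f ⊛ g)
        ≈⟨ solve 4 (λ D E f g → D :* E :* (f :* g) := (D :* f) :* (E :* g)) ≐-refl D′ E′ f g ⟩
      (D′ ⊛ f) ⊛ (E′ ⊛ g)
        ≈⟨ *-cong (≃-cross a a′ p) (≃-cross b b′ q) ⟩
      (D ⊛ f′) ⊛ (E ⊛ g′)
        ≈⟨ solve 4 (λ D E f g → D :* E :* (f :* g) := (D :* f) :* (E :* g)) ≐-refl D E f′ g′ ⟨
      D ⊛ E ⊛ (f′ ⊛ g′) ∎)
    where
    D = xPow d
    D′ = xPow d′
    E = xPow e
    E′ = xPow e′

  ⊖-cong : ∀ a b → a ≃ b → ⊖ a ≃ ⊖ b
  ⊖-cong a@(x⁻ d · f) b@(x⁻ e · g) p = fraction-≃ (⊖ᶠ atom a) (⊖ᶠ atom b) (begin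
    xPow e ⊛ (⊟ f)    ≈⟨ -‿distribʳ-* (xPow e) f ⟨
    ⊟ (xPow e ⊛ f)    ≈⟨ -‿cong (≃-cross a b p) ⟩
    ⊟ (xPow d ⊛ g)    ≈⟨ -‿distribʳ-* (xPow d) g ⟩
    xPow d ⊛ (⊟ g)    ∎)

  ⊕-assoc : ∀ a b c → (a ⊕ b) ⊕ c ≃ a ⊕ (b ⊕ c)
  ⊕-assoc a b c = fraction-≃ (atom a ⊕ᶠ atom b ⊕ᶠ atom c) (atom a ⊕ᶠ (atom b ⊕ᶠ atom c))
    (solve 6 (λ D f E g H k →
         D :* (E :* H) :* (H :* (E :* f :+ D :* g) :+ D :* E :* k)
      := D :* E :* H :* (E :* H :* f :+ D :* (H :* g :+ E :* k)))
      ≐-refl (xPow (poleBound a)) (series a) (xPow (poleBound b)) (series b) (xPow (poleBound c)) (series c))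

  ⊕-comm : ∀ a b → a ⊕ b ≃ b ⊕ a
  ⊕-comm a b = fraction-≃ (atom a ⊕ᶠ atom b) (atom b ⊕ᶠ atom a)
    (solve 4 (λ D f E g → E :* D :* (E :* f :+ D :* g) := D :* E :* (D :* g :+ E :* f))
      ≐-refl (xPow (poleBound a)) (series a) (xPow (poleBound b)) (series b))

  ⊕-identityˡ : ∀ a → 0ᴸ ⊕ a ≃ a
  ⊕-identityˡ a = fraction-≃ (0ᶠ ⊕ᶠ atom a) (atom a)
    (solve 2 (λ D f → D :* (D :* con 0 :+ con 1 :* f) := con 1 :* D :* f)
      ≐-refl (xPow (poleBound a)) (series a))

  ⊕-identityʳ : ∀ a → a ⊕ 0ᴸ ≃ a
  ⊕-identityʳ a = ≃-trans (a ⊕ 0ᴸ) (0ᴸ ⊕ a) a (⊕-comm a 0ᴸ) (⊕-identityˡ a)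

  ⊖-inverseˡ : ∀ a → (⊖ a) ⊕ a ≃ 0ᴸ
  ⊖-inverseˡ a@(x⁻ d · f) = fraction-≃ ((⊖ᶠ atom a) ⊕ᶠ atom a) 0ᶠ (begin
    constant 1ℚ ⊛ (D ⊛ (⊟ f) ⊞ D ⊛ f)  ≈⟨ *-congˡ {constant 1ℚ} (+-congʳ {D ⊛ f} (-‿distribʳ-* D f)) ⟨
    constant 1ℚ ⊛ (⊟ (D ⊛ f) ⊞ D ⊛ f)  ≈⟨ *-congˡ {constant 1ℚ} (-‿inverseˡ (D ⊛ f)) ⟩
    constant 1ℚ ⊛ constant 0ℚ          ≈⟨ solve 1 (λ D → con 1 :* con 0 := D :* D :* con 0) ≐-refl D ⟩
    D ⊛ D ⊛ constant 0ℚ                ∎)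
    where D = xPow d

  ⊖-inverseʳ : ∀ a → a ⊕ (⊖ a) ≃ 0ᴸ
  ⊖-inverseʳ a = ≃-trans (a ⊕ (⊖ a)) ((⊖ a) ⊕ a) 0ᴸ (⊕-comm a (⊖ a)) (⊖-inverseˡ a)

  ⊗-assoc : ∀ a b c → (a ⊗ b) ⊗ c ≃ a ⊗ (b ⊗ c)
  ⊗-assoc a b c = fraction-≃ (atom a ⊗ᶠ atom b ⊗ᶠ atom c) (atom a ⊗ᶠ (atom b ⊗ᶠ atom c))
    (solve 6 (λ D f E g H k → D :* (E :* H) :* (f :* g :* k) := D :* E :* H :* (f :* (g :* k)))
      ≐-refl (xPow (poleBound a)) (series a) (xPow (poleBound b)) (series b) (xPow (poleBound c)) (series c))

  ⊗-comm : ∀ a b → a ⊗ b ≃ b ⊗ a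
  ⊗-comm a b = fraction-≃ (atom a ⊗ᶠ atom b) (atom b ⊗ᶠ atom a)
    (solve 4 (λ D f E g → E :* D :* (f :* g) := D :* E :* (g :* f))
      ≐-refl (xPow (poleBound a)) (series a) (xPow (poleBound b)) (series b))

  ⊗-identityˡ : ∀ a → 1ᴸ ⊗ a ≃ a
  ⊗-identityˡ a = fraction-≃ (1ᶠ ⊗ᶠ atom a) (atom a)
    (solve 2 (λ D f → D :* (con 1 :* f) := con 1 :* D :* f) ≐-refl (xPow (poleBound a)) (series a))

  ⊗-identityʳ : ∀ a → a ⊗ 1ᴸ ≃ a
  ⊗-identityʳ a = ≃-trans (a ⊗ 1ᴸ) (1ᴸ ⊗ a) a (⊗-comm a 1ᴸ) (⊗-identityˡ a)

  ⊗-distribˡ-⊕ : ∀ a b c → a ⊗ (b ⊕ c) ≃ (a ⊗ b) ⊕ (a ⊗ c)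
  ⊗-distribˡ-⊕ a b c = fraction-≃ (atom a ⊗ᶠ (atom b ⊕ᶠ atom c)) ((atom a ⊗ᶠ atom b) ⊕ᶠ (atom a ⊗ᶠ atom c))
    (solve 6 (λ D f E g H k →
         D :* E :* (D :* H) :* (f :* (H :* g :+ E :* k))
      := D :* (E :* H) :* (D :* H :* (f :* g) :+ D :* E :* (f :* k)))
      ≐-refl (xPow (poleBound a)) (series a) (xPow (poleBound b)) (series b) (xPow (poleBound c)) (series c))

  ⊗-distribʳ-⊕ : ∀ a b c → (b ⊕ c) ⊗ a ≃ (b ⊗ a) ⊕ (c ⊗ a)
  ⊗-distribʳ-⊕ a b c = fraction-≃ ((atom b ⊕ᶠ atom c) ⊗ᶠ atom a) ((atom b ⊗ᶠ atom a) ⊕ᶠ (atom c ⊗ᶠ atom a))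
    (solve 6 (λ D f E g H k →
         E :* D :* (H :* D) :* ((H :* g :+ E :* k) :* f)
      := E :* H :* D :* (H :* D :* (g :* f) :+ E :* D :* (k :* f)))
      ≐-refl (xPow (poleBound a)) (series a) (xPow (poleBound b)) (series b) (xPow (poleBound c)) (series c))

  laurentCommutativeRing : CommutativeRing 0ℓ 0ℓ
  laurentCommutativeRing = record
    { RawRing laurentRing
    ; isCommutativeRing = record
      { isRing = record
        { +-isAbelianGroup = record
          { isGroup = record
            { isMonoid = record
              { isSemigroup = record
                { isMagma = record
                  { isEquivalence = record
                    { refl  = λ _ → refl
                    ; sym   = λ {a} {b} → ≃-sym a b
                    ; trans = λ {a} {b} {c} → ≃-trans a b c
                    }
                  ; ∙-cong = λ {a} {a′} {b} {b′} → ⊕-cong a a′ b b′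
                  }
                ; assoc = ⊕-assoc
                }
              ; identity = ⊕-identityˡ , ⊕-identityʳ
              }
            ; inverse = ⊖-inverseˡ , ⊖-inverseʳ
            ; ⁻¹-cong = λ {a} {b} → ⊖-cong a b
            }
          ; comm = ⊕-comm
          }
        ; *-cong     = λ {a} {a′} {b} {b′} → ⊗-cong a a′ b b′
        ; *-assoc    = ⊗-assoc
        ; *-identity = ⊗-identityˡ , ⊗-identityʳ
        ; distrib    = ⊗-distribˡ-⊕ , ⊗-distribʳ-⊕
        }
      ; *-comm = ⊗-comm
      }
    }

-- 132-avoiding involutions

Increasing : ∀ {k n} → (Fin k → Fin n) → Set
Increasing f = f Preserves _<_ ⟶ _<_

HasChain : ℕ → ∀ {n} → (Fin n → Fin n) → Set
HasChain k {n} f = ∃[ ι ] Increasing {k} {n} ι × Increasing (f ∘ ι)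

-- Good k m f: f is a 12…k- and 132-avoiding involution, increasing on the
-- positions m, m+1, …
record Good (k m : ℕ) {n} (f : Fin n → Fin n) : Set where
  field
    involutive : ∀ i → f (f i) ≡ i
    avoids132  : ∀ a b d → a < b → b < d → f a < f d → ¬ f d < f b
    noChain    : ¬ HasChain k f
    increasesFrom : ∀ i j → m ℕ.≤ toℕ i → i < j → f i < f j

  injective : ∀ {i j} → f i ≡ f j → i ≡ j
  injective {i} {j} eq = trans (sym (involutive i)) (trans (cong f eq) (involutive j))

Increasing-reflects : ∀ {k n} {f : Fin k → Fin n} → Increasing f → ∀ {i j} → f i < f j → i < j
Increasing-reflects {f = f} inc {i} {j} fi<fj with Fin.<-cmp i j
... | tri< i<j _ _  = i<j
... | tri≈ _ refl _ = contradiction fi<fj (Fin.<-irrefl refl)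
... | tri> _ _ j<i  = contradiction (inc j<i) (Fin.<-asym fi<fj)

-- Each of the k steps raises the value by at least one. This bounds a chain by its first position
-- or its first value.
Increasing-length : ∀ {k n} (f : Fin (suc k) → Fin n) → Increasing f → toℕ (f zero) ℕ.+ k ℕ.< n
Increasing-length {zero}  f inc rewrite ℕ.+-identityʳ (toℕ (f zero)) = Fin.toℕ<n (f zero)
Increasing-length {suc k} f inc rewrite ℕ.+-suc (toℕ (f zero)) k =
  ℕ.≤-<-trans (ℕ.+-monoˡ-≤ k (inc z<s)) (Increasing-length (f ∘ suc) (inc ∘ s<s))

-- The identity contains chains up to length n, hence the bound n < k.
Good-identity : ∀ {k n} → n ℕ.< k → Good k 0 {n} id
Good-identity {suc k} {n} (s≤s n≤k) = record
  { involutive = λ _ → refl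
  ; avoids132  = λ a b d a<b b<d _ d<b → Fin.<-asym b<d d<b
  ; noChain    = λ (ι , inc , _) →
      ℕ.<⇒≱ (ℕ.≤-<-trans (ℕ.m≤n+m k (toℕ (ι zero))) (Increasing-length ι inc)) n≤k
  ; increasesFrom = λ _ _ _ i<j → i<j
  }

-- If an increasing involution moved i, applying f to the inequality between f i and i would reverse
-- it.
Good-zero⇒identity : ∀ {k n} {f : Fin n → Fin n} → Good k 0 f → ∀ i → f i ≡ i
Good-zero⇒identity {f = f} good i with Fin.<-cmp (f i) i
... | tri≈ _ fi≡i _ = fi≡i
... | tri< fi<i _ _ = contradiction fi<i (Fin.<-asym (subst (_< f i) (involutive i) (increasesFrom _ _ z≤n fi<i)))
  where open Good good
... | tri> _ _ i<fi = contradiction i<fi (Fin.<-asym (subst (f i <_) (involutive i) (increasesFrom _ _ z≤n i<fi)))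
  where open Good good

Good-weaken : ∀ {k m m′ n} {f : Fin n → Fin n} → m ℕ.≤ m′ → Good k m f → Good k m′ f
Good-weaken m≤m′ good = record
  { involutive = involutive
  ; avoids132  = avoids132
  ; noChain    = noChain
  ; increasesFrom = λ i j m′≤i → increasesFrom i j (ℕ.≤-trans m≤m′ m′≤i)
  }
  where open Good good

-- With n ≤ m at most one position is left from m on, so there is nothing to compare. This gives
-- B(m+1,0) = B(m,1).
Good-last : ∀ {k m n} {f : Fin (suc n) → Fin (suc n)} → n ℕ.≤ m → Good k (suc m) f → Good k m f
Good-last n≤m good = record
  { involutive = involutive
  ; avoids132  = avoids132
  ; noChain    = noChain
  ; increasesFrom = λ i j m≤i i<j →
      contradiction (ℕ.≤-<-trans (ℕ.≤-trans n≤m m≤i) i<j) (ℕ.≤⇒≯ (Fin.toℕ≤pred[n] j))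
  }
  where open Good good

Good-bound : ∀ {k m s} {f : Fin (m ℕ.+ s) → Fin (m ℕ.+ s)} → Good k m f → s ℕ.< k
Good-bound {k} {m} {s} {f} good = ℕ.≰⇒> λ k≤s →
  let ι : Fin k → Fin (m ℕ.+ s)
      -- The first k of the last s positions form the forbidden chain.
      ι i = m ↑ʳ inject≤ i k≤s
      toℕ-ι : ∀ i → toℕ (ι i) ≡ m ℕ.+ toℕ i
      toℕ-ι i = trans (Fin.toℕ-↑ʳ m _) (cong (m ℕ.+_) (Fin.toℕ-inject≤ i k≤s))
      ι-inc : Increasing ι
      ι-inc {i} {j} i<j = subst₂ ℕ._<_ (sym (toℕ-ι i)) (sym (toℕ-ι j)) (ℕ.+-monoʳ-< m i<j)
  in noChain (ι , ι-inc , λ {i} {j} i<j →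
       increasesFrom (ι i) (ι j) (subst (m ℕ.≤_) (sym (toℕ-ι i)) (ℕ.m≤m+n m (toℕ i))) (ι-inc i<j))
  where open Good good

-- Inserting and deleting the 2-cycle that exchanges 0 and c + 1

module _ {n} (c : Fin (suc n)) where

  -- The increasing bijection onto the complement of {0, c + 1}; it relabels both positions and
  -- values.
  embed : Fin n → Fin (2 ℕ.+ n)
  embed j = suc (punchIn c j)

  embed-increasing : Increasing embed
  embed-increasing {i} {j} i<j = s<s (ℕ.≰⇒> λ q → ℕ.<⇒≱ i<j (Fin.punchIn-cancel-≤ c j i q))

  embed-reflects : ∀ {i j} → embed i < embed j → i < j
  embed-reflects = Increasing-reflects embed-increasing

  embed-injective : ∀ {i j} → embed i ≡ embed j → i ≡ j
  embed-injective {i} {j} eq = Fin.punchIn-injective c i j (Fin.suc-injective eq)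

  data Position : Fin (2 ℕ.+ n) → Set where
    first  : Position zero
    second : Position (suc c)
    other  : ∀ j → Position (embed j)

  position : ∀ i → Position i
  position zero = first
  position (suc i) with c Fin.≟ i
  ... | yes refl = second
  ... | no c≢i   = subst (Position ∘ suc) (Fin.punchIn-punchOut c≢i) (other (punchOut c≢i))

  embed≢second : ∀ j → embed j ≢ suc c
  embed≢second j = Fin.punchInᵢ≢i c j ∘ Fin.suc-injective

  other-position : ∀ i → i ≢ zero → i ≢ suc c → ∃[ j ] i ≡ embed j
  other-position i i≢0 i≢c+1 with position i
  ... | first   = contradiction refl i≢0
  ... | second  = contradiction refl i≢c+1
  ... | other j = j , refl

  -- A relation, because it is entered from both sides: insertion constructs f from g, deletion
  -- recovers g from f.
  record Extends (g : Fin n → Fin n) (f : Fin (2 ℕ.+ n) → Fin (2 ℕ.+ n)) : Set where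
    field
      at-first  : f zero ≡ suc c
      at-second : f (suc c) ≡ zero
      at-other  : ∀ j → f (embed j) ≡ embed (g j)

  Extends-unique : ∀ {g f f′} → Extends g f → Extends g f′ → ∀ i → f i ≡ f′ i
  Extends-unique p q i with position i
  ... | first   = trans (Extends.at-first p) (sym (Extends.at-first q))
  ... | second  = trans (Extends.at-second p) (sym (Extends.at-second q))
  ... | other j = trans (Extends.at-other p j) (sym (Extends.at-other q j))

-- `punchIn c` fixes the indices below c and raises the others by one. Hence an entry of f after
-- position c + 1 comes from an entry of g at position c or later.
c≤punchIn⇒c≤ : ∀ {n} (c : Fin (suc n)) j → toℕ c ℕ.≤ toℕ (punchIn c j) → toℕ c ℕ.≤ toℕ j
c≤punchIn⇒c≤ zero    j       _       = z≤n
c≤punchIn⇒c≤ (suc c) (suc j) (s≤s q) = s≤s (c≤punchIn⇒c≤ c j q)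

j≤punchIn : ∀ {n} (c : Fin (suc n)) j → toℕ j ℕ.≤ toℕ (punchIn c j)
j≤punchIn zero    j       = ℕ.n≤1+n _
j≤punchIn (suc c) zero    = z≤n
j≤punchIn (suc c) (suc j) = s≤s (j≤punchIn c j)

module _ {n} {c : Fin (suc n)} {g : Fin n → Fin n} {f} (ext : Extends c g f) where
  open Extends ext
  private
    m = toℕ c

    at-other-< : ∀ {i j} → f (embed c i) < f (embed c j) → g i < g j
    at-other-< {i} {j} = embed-reflects c ∘ subst₂ _<_ (at-other i) (at-other j)

    at-other-<⁺ : ∀ {i j} → g i < g j → f (embed c i) < f (embed c j)
    at-other-<⁺ {i} {j} = subst₂ _<_ (sym (at-other i)) (sym (at-other j)) ∘ embed-increasing c

    f-second-minimal : ∀ i → ¬ f i < f (suc c)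
    f-second-minimal i lt with () ← subst (f i <_) at-second lt

    f-other>0 : ∀ j → f (suc c) < f (embed c j)
    f-other>0 j = subst₂ _<_ (sym at-second) (sym (at-other j)) z<s

  -- `embed c` is increasing, so a 132 pattern or a chain in g reappears in f. It also sends
  -- positions from m on to positions from m + 1 on.
  Extends-restrict : ∀ {k} → Good k (suc m) f → Good k m g
  Extends-restrict good = record
    { involutive = λ i → embed-injective c (trans (sym (at-other (g i)))
        (trans (cong f (sym (at-other i))) (involutive (embed c i))))
    ; avoids132 = λ a b d a<b b<d ga<gd gd<gb →
        avoids132 (embed c a) (embed c b) (embed c d) (embed-increasing c a<b) (embed-increasing c b<d)
          (at-other-<⁺ ga<gd) (at-other-<⁺ gd<gb)
    ; noChain = λ (ι , inc , inc′) →
        noChain (embed c ∘ ι , embed-increasing c ∘ inc , at-other-<⁺ ∘ inc′)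
    ; increasesFrom = λ i j m≤i i<j → at-other-<
        (increasesFrom (embed c i) (embed c j) (s≤s (ℕ.≤-trans m≤i (j≤punchIn c i))) (embed-increasing c i<j))
    }
    where open Good good

  module _ {k} (good : Good k m g) where
    open Good good

    Extends-involutive : ∀ i → f (f i) ≡ i
    Extends-involutive i with position c i
    ... | first   = trans (cong f at-first) at-second
    ... | second  = trans (cong f at-second) at-first
    ... | other j = trans (cong f (at-other j)) (trans (at-other (g j)) (cong (embed c) (involutive j)))

    -- Position c + 1 carries the value 0 and so lies below all later entries; among those the order
    -- is inherited from g.
    Extends-increasesFrom : ∀ i j → suc m ℕ.≤ toℕ i → i < j → f i < f j
    Extends-increasesFrom i j m<i i<j with position c i | position c j
    ... | second   | second   = contradiction i<j (Fin.<-irrefl refl)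
    ... | second   | other j′ = f-other>0 j′
    ... | other i′ | second   = contradiction i<j (ℕ.≤⇒≯ m<i)
    ... | other i′ | other j′ = at-other-<⁺
      (increasesFrom i′ j′ (c≤punchIn⇒c≤ c i′ (ℕ.s≤s⁻¹ m<i)) (embed-reflects c i<j))

    Extends-avoids132 : ∀ a b d → a < b → b < d → f a < f d → ¬ f d < f b
    Extends-avoids132 a b d a<b b<d fa<fd fd<fb with position c a | position c b | position c d
    -- By involutivity the values above f 0 = c + 1 occur in increasing order,
    -- like the entries after position c + 1.
    ... | first | _ | _ = Fin.<-asym b<d
      (subst₂ _<_ (Extends-involutive d) (Extends-involutive b)
        (Extends-increasesFrom (f d) (f b) (ℕ.<⇒≤ (subst (_< f d) at-first fa<fd)) fd<fb))
    ... | second | _ | _ = Fin.<-asym fd<fb (Extends-increasesFrom b d (ℕ.<⇒≤ a<b) b<d)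
    -- In the next two cases an entry would have to be smaller than the value 0 at position c + 1.
    ... | other _ | second | _ = f-second-minimal d fd<fb
    ... | other a′ | other b′ | second = f-second-minimal _ fa<fd
    ... | other a′ | other b′ | other d′ = avoids132 a′ b′ d′ (embed-reflects c a<b) (embed-reflects c b<d)
      (at-other-< fa<fd) (at-other-< fd<fb)

  -- A chain meeting position 0 or position c + 1 starts there, which leaves
  -- room for at most n - c elements.
  Extends-noChain : ∀ {k} → Good k m g → n ℕ.< m ℕ.+ ℕ.pred k → ¬ HasChain k f
  -- For k = 0 the empty map is already a chain in g, contradicting `good`.
  Extends-noChain {zero}  good _ _ = Good.noChain good ((λ ()) , (λ {}) , (λ {}))
  Extends-noChain {suc k} good n<m+k (ι , inc , inc′) = Good.noChain good
    ( proj₁ ∘ pull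
    , (λ {i} {j} i<j → embed-reflects c (subst₂ _<_ (proj₂ (pull i)) (proj₂ (pull j)) (inc i<j)))
    , (λ {i} {j} i<j → at-other-<
        (subst₂ _<_ (cong f (proj₂ (pull i))) (cong f (proj₂ (pull j))) (inc′ i<j))) )
    where
    too-long : ∀ (h : Fin (suc k) → Fin (2 ℕ.+ n)) → Increasing h → h zero ≢ suc c
    too-long h h-inc eq = ℕ.<⇒≱ n<m+k (ℕ.s≤s⁻¹ (ℕ.s≤s⁻¹
      (subst (λ z → toℕ z ℕ.+ k ℕ.< 2 ℕ.+ n) eq (Increasing-length h h-inc))))

    ≢first : ∀ i → ι i ≢ zero
    -- From position 0 the values of the chain start at c + 1; from position c + 1 its positions do.
    -- The same length bound serves both.
    ≢first zero    eq = too-long (f ∘ ι) inc′ (trans (cong f eq) at-first)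
    ≢first (suc i) eq with () ← subst (ι zero <_) eq (inc z<s)

    ≢second : ∀ i → ι i ≢ suc c
    ≢second zero    eq = too-long ι inc eq
    ≢second (suc i) eq = f-second-minimal (ι zero) (subst (f (ι zero) <_) (cong f eq) (inc′ z<s))

    pull : ∀ i → ∃[ j ] ι i ≡ embed c j
    pull i = other-position c (ι i) (≢first i) (≢second i)

  Extends-good : ∀ {k} → n ℕ.< m ℕ.+ ℕ.pred k → Good k m g → Good k (suc m) f
  Extends-good n<m+k good = record
    { involutive    = Extends-involutive good
    ; avoids132     = Extends-avoids132 good
    ; noChain       = Extends-noChain good n<m+k
    ; increasesFrom = Extends-increasesFrom good
    }

-- Index c of the tail is position c + 1 of the whole word, so the value 0 lands there.
insertCycle : ∀ {n} → Fin (suc n) → Vec (Fin n) n → Vec (Fin (2 ℕ.+ n)) (2 ℕ.+ n)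
insertCycle c v = suc c ∷ insertAt (map (embed c) v) c zero

insertCycle-extends : ∀ {n} (c : Fin (suc n)) v → Extends c (lookup v) (lookup (insertCycle c v))
insertCycle-extends c v = record
  { at-first  = refl
  ; at-second = insertAt-lookup (map (embed c) v) c zero
  ; at-other  = λ j → trans (insertAt-punchIn (map (embed c) v) c zero j) (lookup-map j (embed c) v)
  }

lookup-extensional : ∀ {n k} {v w : Vec (Fin n) k} → (∀ i → lookup v i ≡ lookup w i) → v ≡ w
lookup-extensional {v = v} {w} eq =
  trans (sym (tabulate∘lookup v)) (trans (tabulate-cong eq) (tabulate∘lookup w))

insertCycle-injective : ∀ {n} (c : Fin (suc n)) {v w} → insertCycle c v ≡ insertCycle c w → v ≡ w
insertCycle-injective c {v} {w} eq = lookup-extensional λ j → embed-injective c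
  (trans (sym (Extends.at-other (insertCycle-extends c v) j))
    (trans (cong (λ u → lookup u (embed c j)) eq) (Extends.at-other (insertCycle-extends c w) j)))

-- Ascent or descent from position m to position m + 1

module _ {k n} {c : Fin (suc n)} (α : Vec (Fin (2 ℕ.+ n)) (2 ℕ.+ n)) (good : Good k (suc (toℕ c)) (lookup α)) where
  private
    f = lookup α
    m = toℕ c
    p q : Fin (2 ℕ.+ n)
    p = inject₁ c
    q = suc c

    toℕ-p : toℕ p ≡ m
    toℕ-p = Fin.toℕ-inject₁ c

    p<q : p < q
    p<q = s≤s (ℕ.≤-reflexive toℕ-p)
  open Good good

  ascent⇒Good : f p < f q → Good k m f
  ascent⇒Good fp<fq = record
    { involutive    = involutive
    ; avoids132     = avoids132
    ; noChain       = noChain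
    ; increasesFrom = increasing′
    }
    where
    increasing′ : ∀ i j → m ℕ.≤ toℕ i → i < j → f i < f j
    increasing′ i j m≤i i<j with ℕ.m≤n⇒m<n∨m≡n m≤i
    ... | inj₁ m<i = increasesFrom i j m<i i<j
    ... | inj₂ m≡i with refl ← Fin.toℕ-injective (trans toℕ-p m≡i) with Fin.<-cmp q j
    ...   | tri≈ _ refl _ = fp<fq
    ...   | tri< q<j _ _  = Fin.<-trans fp<fq (increasesFrom q j ℕ.≤-refl q<j)
    ...   | tri> _ _ j<q  = contradiction (subst (ℕ._< toℕ j) toℕ-p i<j) (ℕ.≤⇒≯ (ℕ.s≤s⁻¹ j<q))

  module _ (fp≮fq : ¬ f p < f q) where
    private
      fq<fp : f q < f p
      fq<fp with Fin.<-cmp (f p) (f q)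
      ... | tri< fp<fq _ _ = contradiction fp<fq fp≮fq
      ... | tri≈ _ fp≡fq _ = contradiction p<q (Fin.<-irrefl (injective fp≡fq))
      ... | tri> _ _ lt    = lt

      z : Fin (2 ℕ.+ n)
      z = f zero

      -- By involutivity `f z` is 0, a value taken only at z.
      fz<f : ∀ {i} → z ≢ i → f z < f i
      fz<f {i} z≢i rewrite involutive zero = ℕ.n≢0⇒n>0 λ fi≡0 →
        z≢i (sym (trans (sym (involutive i)) (cong f (Fin.toℕ-injective fi≡0))))

    -- Otherwise the value 0 would lie left of p, giving a 132 pattern with
    -- the descent at p and q, or right of q, inside the increasing part.
    descent⇒f0≡q : f zero ≡ q
    descent⇒f0≡q with Fin.<-cmp z q
    ... | tri≈ _ z≡q _ = z≡q
    ... | tri> _ z≢q q<z = contradiction (fz<f z≢q) (Fin.<-asym (increasesFrom q z ℕ.≤-refl q<z))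
    ... | tri< z<q z≢q _ with Fin.<-cmp z p
    ...   | tri< z<p _ _  = contradiction fq<fp (avoids132 z p q z<p p<q (fz<f z≢q))
    ...   | tri≈ _ z≡p _  = contradiction (fz<f z≢q) (Fin.<-asym (subst (λ i → f q < f i) (sym z≡p) fq<fp))
    ...   | tri> _ _ p<z  = contradiction (subst (ℕ._< toℕ z) toℕ-p p<z) (ℕ.≤⇒≯ (ℕ.s≤s⁻¹ z<q))

    private
      fq≡0 : f q ≡ zero
      fq≡0 = trans (cong f (sym descent⇒f0≡q)) (involutive zero)

      restrict : ∀ j → ∃[ j′ ] f (embed c j) ≡ embed c j′
      restrict j = other-position c (f (embed c j))
        (λ eq → embed≢second c j (injective (trans eq (sym fq≡0))))
        (λ eq → Fin.0≢1+n (sym (injective (trans eq (sym descent⇒f0≡q)))))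

    -- As f exchanges 0 and q, injectivity makes it preserve the complement of {0, q}; β is its
    -- restriction, read through `embed c`.
    descent⇒insertCycle : ∃[ β ] Good k m (lookup β) × α ≡ insertCycle c β
    descent⇒insertCycle = β , Extends-restrict ext good
      , lookup-extensional (Extends-unique c ext (insertCycle-extends c β))
      where
      β = tabulate (proj₁ ∘ restrict)
      ext : Extends c (lookup β) f
      ext = record
        { at-first  = descent⇒f0≡q
        ; at-second = fq≡0
        ; at-other  = λ j → trans (proj₂ (restrict j)) (cong (embed c) (sym (lookup∘tabulate _ j)))
        }

-- Enumeration of the involutions counted by B(m,s)

Good-cong : ∀ {k m n} {f g : Fin n → Fin n} → (∀ i → f i ≡ g i) → Good k m f → Good k m g
Good-cong {f = f} {g} f≗g good = record
  { involutive = λ i → trans (sym (f≗g (g i))) (trans (cong f (sym (f≗g i))) (involutive i))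
  ; avoids132  = λ a b d a<b b<d ga<gd gd<gb →
      avoids132 a b d a<b b<d (back ga<gd) (back gd<gb)
  ; noChain    = λ (ι , inc , inc′) → noChain (ι , inc , back ∘ inc′)
  ; increasesFrom = λ i j m≤i i<j → subst₂ _<_ (f≗g i) (f≗g j) (increasesFrom i j m≤i i<j)
  }
  where
  open Good good
  back : ∀ {i j} → g i < g j → f i < f j
  back {i} {j} = subst₂ _<_ (sym (f≗g i)) (sym (f≗g j))

-- The length n comes with an equation because m + (2 + s) and 2 + (m + s) agree only up to a proof.
goodInvolutions : ∀ k m s {n} → m ℕ.+ s ≡ n → List (Vec (Fin n) n)

private
  goodInvolutions⁺ : ∀ k m s {n} → m ℕ.+ s ≡ n → List (Vec (Fin n) n)
  goodInvolutionsCycle : ∀ k m s {n} → 2 ℕ.+ (m ℕ.+ s) ≡ n → List (Vec (Fin n) n)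

  m+2+s : ∀ m s → m ℕ.+ (2 ℕ.+ s) ≡ 2 ℕ.+ (m ℕ.+ s)
  m+2+s m s = trans (ℕ.+-suc m (suc s)) (cong suc (ℕ.+-suc m s))

  1+m+1+s : ∀ m s {n} → suc m ℕ.+ suc s ≡ n → 2 ℕ.+ (m ℕ.+ s) ≡ n
  1+m+1+s m s = trans (cong suc (sym (ℕ.+-suc m s)))

goodInvolutions k m s eq with s ℕ.<? k
... | no _  = List.[]
... | yes _ = goodInvolutions⁺ k m s eq

goodInvolutions⁺ k zero    s       refl = List.[ allFin s ]
goodInvolutions⁺ k (suc m) zero    eq   = goodInvolutions k m 1 (trans (ℕ.+-suc m 0) eq)
goodInvolutions⁺ k (suc m) (suc s) eq   = goodInvolutionsCycle k m s (1+m+1+s m s eq)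

goodInvolutionsCycle k m s refl =
  -- First the words with an ascent from m to m + 1, then those with a descent; `fromℕ m ↑ˡ s` is
  -- the index m.
  goodInvolutions k m (2 ℕ.+ s) (m+2+s m s) List.++
  List.map (insertCycle (fromℕ m ↑ˡ s)) (goodInvolutions k m s refl)

private
  toℕ-c : ∀ m s → toℕ (fromℕ m ↑ˡ s) ≡ m
  toℕ-c m s = trans (Fin.toℕ-↑ˡ (fromℕ m) s) (Fin.toℕ-fromℕ m)

goodInvolutions-sound : ∀ k m s {n} (eq : m ℕ.+ s ≡ n) {α} →
  α ∈ goodInvolutions k m s eq → Good k m (lookup α)
goodInvolutionsCycle-sound : ∀ k m s {n} (eq : 2 ℕ.+ (m ℕ.+ s) ≡ n) {α} → suc s ℕ.< k →
  α ∈ goodInvolutionsCycle k m s eq → Good k (suc m) (lookup α)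

goodInvolutions-sound k m s eq α∈ with s ℕ.<? k
goodInvolutions-sound k m       s       eq   ()          | no _
goodInvolutions-sound k zero    s       refl (here refl) | yes s<k =
  Good-cong (sym ∘ lookup-allFin) (Good-identity s<k)
goodInvolutions-sound k (suc m) zero    eq   α∈          | yes _   =
  Good-weaken (ℕ.n≤1+n m) (goodInvolutions-sound k m 1 _ α∈)
goodInvolutions-sound k (suc m) (suc s) eq   α∈          | yes s<k =
  goodInvolutionsCycle-sound k m s (1+m+1+s m s eq) s<k α∈

goodInvolutionsCycle-sound k m s refl s<k α∈ with ∈-++⁻ (goodInvolutions k m (2 ℕ.+ s) (m+2+s m s)) α∈
... | inj₁ α∈ˡ = Good-weaken (ℕ.n≤1+n m) (goodInvolutions-sound k m (2 ℕ.+ s) _ α∈ˡ)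
... | inj₂ α∈ʳ with β , β∈ , refl ← ∈-map⁻ _ α∈ʳ =
  Good-weaken (s≤s (ℕ.≤-reflexive (toℕ-c m s)))
    (Extends-good (insertCycle-extends (fromℕ m ↑ˡ s) β)
      -- The strip condition s + 1 < k is what keeps chains through the new 2-cycle too short.
      (subst (λ x → m ℕ.+ s ℕ.< x ℕ.+ ℕ.pred k) (sym (toℕ-c m s))
        (ℕ.+-monoʳ-< m (ℕ.<⇒≤pred s<k)))
      (Good-weaken (ℕ.≤-reflexive (sym (toℕ-c m s))) (goodInvolutions-sound k m s refl β∈)))

goodInvolutions-complete : ∀ k m s {n} (eq : m ℕ.+ s ≡ n) {α} →
  Good k m (lookup α) → α ∈ goodInvolutions k m s eq
goodInvolutionsCycle-complete : ∀ k m s {n} (eq : 2 ℕ.+ (m ℕ.+ s) ≡ n) {α} →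
  Good k (suc m) (lookup α) → α ∈ goodInvolutionsCycle k m s eq

goodInvolutions-complete k m s eq good with s ℕ.<? k
goodInvolutions-complete k m s refl good | no s≮k = contradiction (Good-bound {m = m} good) s≮k
goodInvolutions-complete k zero    s       refl good | yes _ =
  here (lookup-extensional λ i → trans (Good-zero⇒identity good i) (sym (lookup-allFin i)))
goodInvolutions-complete k (suc m) zero    refl good | yes _ = goodInvolutions-complete k m 1 _
  (Good-last (ℕ.≤-reflexive (ℕ.+-identityʳ m)) good)
goodInvolutions-complete k (suc m) (suc s) eq   good | yes _ =
  goodInvolutionsCycle-complete k m s (1+m+1+s m s eq) good

goodInvolutionsCycle-complete k m s refl {α} good =
  go (Good-weaken (s≤s (ℕ.≤-reflexive (sym (toℕ-c m s)))) good)
  where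
  c = fromℕ m ↑ˡ s
  go : Good k (suc (toℕ c)) (lookup α) → α ∈ goodInvolutionsCycle k m s refl
  go good′ with lookup α (inject₁ c) Fin.<? lookup α (suc c)
  ... | yes ascent = ∈-++⁺ˡ (goodInvolutions-complete k m (2 ℕ.+ s) (m+2+s m s)
    (Good-weaken (ℕ.≤-reflexive (toℕ-c m s)) (ascent⇒Good α good′ ascent)))
  ... | no descent with β , good-β , refl ← descent⇒insertCycle α good′ descent =
    ∈-++⁺ʳ _ (∈-map⁺ (insertCycle c) (goodInvolutions-complete k m s refl
      (Good-weaken (ℕ.≤-reflexive (toℕ-c m s)) good-β)))

goodInvolutions-unique : ∀ k m s {n} (eq : m ℕ.+ s ≡ n) → Unique (goodInvolutions k m s eq)
goodInvolutionsCycle-unique : ∀ k m s {n} (eq : 2 ℕ.+ (m ℕ.+ s) ≡ n) → Unique (goodInvolutionsCycle k m s eq)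

goodInvolutions-unique k m s eq with s ℕ.<? k
goodInvolutions-unique k m       s       eq   | no _  = AllPairs.[]
goodInvolutions-unique k zero    s       refl | yes _ = All.[] AllPairs.∷ AllPairs.[]
goodInvolutions-unique k (suc m) zero    eq   | yes _ = goodInvolutions-unique k m 1 _
goodInvolutions-unique k (suc m) (suc s) eq   | yes _ = goodInvolutionsCycle-unique k m s (1+m+1+s m s eq)

goodInvolutionsCycle-unique k m s refl = Unique.++⁺
  (goodInvolutions-unique k m (2 ℕ.+ s) (m+2+s m s))
  (Unique.map⁺ (insertCycle-injective c) (goodInvolutions-unique k m s refl))
  disjoint
  where
  c = fromℕ m ↑ˡ s

  toℕ-p : toℕ (inject₁ c) ≡ m
  toℕ-p = trans (Fin.toℕ-inject₁ c) (toℕ-c m s)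

  -- Words of the first list ascend from m to m + 1, but those of the second have the value 0 at m +
  -- 1.
  disjoint : ∀ {α} → ¬ (α ∈ goodInvolutions k m (2 ℕ.+ s) (m+2+s m s) ×
                        α ∈ List.map (insertCycle c) (goodInvolutions k m s refl))
  disjoint (α∈ˡ , α∈ʳ) with β , _ , refl ← ∈-map⁻ _ α∈ʳ
    with () ← subst (lookup (insertCycle c β) (inject₁ c) <_) (Extends.at-second (insertCycle-extends c β))
      (Good.increasesFrom (goodInvolutions-sound k m (2 ℕ.+ s) (m+2+s m s) α∈ˡ)
        (inject₁ c) (suc c) (ℕ.≤-reflexive (sym toℕ-p)) (s≤s (ℕ.≤-reflexive (Fin.toℕ-inject₁ c))))

-- Walks of m steps ±1 from s inside {0,…,k-1}, weighted by w at the end point.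
walks : (ℕ → ℕ) → ℕ → ℕ → ℕ → ℕ
walks⁺ : (ℕ → ℕ) → ℕ → ℕ → ℕ → ℕ

walks w k m s with s ℕ.<? k
... | no _  = 0
... | yes _ = walks⁺ w k m s

walks⁺ w k zero    s       = w s
walks⁺ w k (suc m) zero    = walks w k m 1
walks⁺ w k (suc m) (suc s) = walks w k m (2 ℕ.+ s) ℕ.+ walks w k m s

length-goodInvolutions : ∀ k m s {n} (eq : m ℕ.+ s ≡ n) →
  length (goodInvolutions k m s eq) ≡ walks (λ _ → 1) k m s
length-goodInvolutionsCycle : ∀ k m s {n} (eq : 2 ℕ.+ (m ℕ.+ s) ≡ n) →
  length (goodInvolutionsCycle k m s eq) ≡ walks (λ _ → 1) k m (2 ℕ.+ s) ℕ.+ walks (λ _ → 1) k m s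

length-goodInvolutions k m s eq with s ℕ.<? k
length-goodInvolutions k m       s       eq   | no _  = refl
length-goodInvolutions k zero    s       refl | yes _ = refl
length-goodInvolutions k (suc m) zero    eq   | yes _ = length-goodInvolutions k m 1 _
length-goodInvolutions k (suc m) (suc s) eq   | yes _ = length-goodInvolutionsCycle k m s (1+m+1+s m s eq)

length-goodInvolutionsCycle k m s refl = trans (List.length-++ (goodInvolutions k m (2 ℕ.+ s) _))
  (cong₂ ℕ._+_ (length-goodInvolutions k m (2 ℕ.+ s) _)
    (trans (List.length-map (insertCycle (fromℕ m ↑ˡ s)) (goodInvolutions k m s refl))
      (length-goodInvolutions k m s refl)))

-- Pattern containment as order conditions on entries

orderIsomorphic : ∀ {k m n} (σ : Vec (Fin m) k) (τ : Vec (Fin n) k) →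
  (∀ {a b} → lookup τ a ≡ lookup τ b → a ≡ b) →
  (∀ a b → lookup τ a < lookup τ b → lookup σ a < lookup σ b) → OrderIsomorphic σ τ
orderIsomorphic σ τ τ-inj τ⇒σ a b = mk⇔ σ⇒τ (τ⇒σ a b)
  where
  σ⇒τ : lookup σ a < lookup σ b → lookup τ a < lookup τ b
  -- Injectivity of τ and trichotomy yield the converse, so one implication suffices for each
  -- pattern.
  σ⇒τ σ< with Fin.<-cmp (lookup τ a) (lookup τ b)
  ... | tri< τ< _ _ = τ<
  ... | tri≈ _ eq _ = contradiction σ< (Fin.<-irrefl (cong (lookup σ) (τ-inj eq)))
  ... | tri> _ _ τ> = contradiction (τ⇒σ b a τ>) (Fin.<-asym σ<)

pattern132-injective : ∀ a b → lookup pattern132 a ≡ lookup pattern132 b → a ≡ b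
pattern132-injective 0F 0F _ = refl
pattern132-injective 1F 1F _ = refl
pattern132-injective 2F 2F _ = refl
pattern132-injective 0F 1F ()
pattern132-injective 0F 2F ()
pattern132-injective 1F 0F ()
pattern132-injective 1F 2F ()
pattern132-injective 2F 0F ()
pattern132-injective 2F 1F ()

contains132⁺ : ∀ {n} (α : Vec (Fin n) n) {a b d} → a < b → b < d →
  lookup α a < lookup α d → lookup α d < lookup α b → Contains pattern132 α
contains132⁺ α {a} {b} {d} a<b b<d αa<αd αd<αb =
  ι , (λ {i} {j} → ι-increasing i j) , orderIsomorphic (map (lookup α) ι) pattern132 (λ {i} {j} → pattern132-injective i j) order
  where
  ι = a ∷ b ∷ d ∷ []

  ι-increasing : ∀ i j → i < j → lookup ι i < lookup ι j
  ι-increasing 0F 1F _ = a<b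
  ι-increasing 0F 2F _ = Fin.<-trans a<b b<d
  ι-increasing 1F 2F _ = b<d
  ι-increasing 1F 1F (s≤s ())
  ι-increasing 2F 1F (s≤s ())
  ι-increasing 2F 2F (s≤s (s≤s ()))

  order : ∀ i j → lookup pattern132 i < lookup pattern132 j →
          lookup (map (lookup α) ι) i < lookup (map (lookup α) ι) j
  order 0F 1F _ = Fin.<-trans αa<αd αd<αb
  order 0F 2F _ = αa<αd
  order 2F 1F _ = αd<αb
  order 1F 1F (s≤s (s≤s ()))
  order 1F 2F (s≤s ())
  order 2F 2F (s≤s ())

contains132⁻ : ∀ {n} (α : Vec (Fin n) n) → Contains pattern132 α →
  ∃[ a ] ∃[ b ] ∃[ d ] a < b × b < d × lookup α a < lookup α d × lookup α d < lookup α b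
contains132⁻ α (a ∷ b ∷ d ∷ [] , inc , iso) =
  a , b , d , inc {0F} {1F} z<s , inc {1F} {2F} (s<s z<s)
  , Equivalence.from (iso 0F 2F) z<s , Equivalence.from (iso 2F 1F) (s<s z<s)

containsIncreasing⁺ : ∀ {k n} (α : Vec (Fin n) n) → HasChain k (lookup α) → Contains (increasing k) α
containsIncreasing⁺ α (ι , inc , inc′) =
    tabulate ι
  , (λ {i} {j} i<j → subst₂ _<_ (sym (lookup∘tabulate ι i)) (sym (lookup∘tabulate ι j)) (inc i<j))
  , orderIsomorphic (map (lookup α) (tabulate ι)) (allFin _) (λ {a} {b} eq → trans (sym (lookup-allFin a)) (trans eq (lookup-allFin b)))
      (λ a b a<b → subst₂ _<_ (sym (αι a)) (sym (αι b))
        (inc′ (subst₂ _<_ (lookup-allFin a) (lookup-allFin b) a<b)))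
  where
  αι : ∀ i → lookup (map (lookup α) (tabulate ι)) i ≡ lookup α (ι i)
  αι i = trans (lookup-map i (lookup α) (tabulate ι)) (cong (lookup α) (lookup∘tabulate ι i))

containsIncreasing⁻ : ∀ {k n} (α : Vec (Fin n) n) → Contains (increasing k) α → HasChain k (lookup α)
containsIncreasing⁻ α (ι , inc , iso) = lookup ι , inc , λ {a} {b} a<b →
  subst₂ _<_ (lookup-map a (lookup α) ι) (lookup-map b (lookup α) ι)
    (Equivalence.from (iso a b) (subst₂ _<_ (sym (lookup-allFin a)) (sym (lookup-allFin b)) a<b))

AvoidingInvolution⇒Good : ∀ {k n} (α : Vec (Fin n) n) → AvoidingInvolution k α → Good k n (lookup α)
AvoidingInvolution⇒Good α ((_ , selfInverse) , avoids132 , avoidsIncreasing) = record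
  { involutive = λ i → selfInverse {i} refl
  ; avoids132  = λ a b d a<b b<d αa<αd αd<αb → avoids132 (contains132⁺ α a<b b<d αa<αd αd<αb)
  ; noChain    = avoidsIncreasing ∘ containsIncreasing⁺ α
  -- For m = n no position is left, so the condition is vacuous.
  ; increasesFrom = λ i _ n≤i _ → contradiction (Fin.toℕ<n i) (ℕ.≤⇒≯ n≤i)
  }

Good⇒AvoidingInvolution : ∀ {k m n} (α : Vec (Fin n) n) → Good k m (lookup α) → AvoidingInvolution k α
Good⇒AvoidingInvolution α good =
    ((injective , strictlySurjective⇒surjective (λ i → lookup α i , involutive i))
    , λ { {i} refl → involutive i })
  , (λ contains → let a , b , d , a<b , b<d , αa<αd , αd<αb = contains132⁻ α contains
                  in avoids132 a b d a<b b<d αa<αd αd<αb)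
  , noChain ∘ containsIncreasing⁻ α
  where open Good good

-- The filtered list of all words and the recursive list have the same members and no repetitions,
-- so they are permutations of each other. The case m = n, s = 0 imposes no increasing end.
numAvoidingInvolutions≡walks : ∀ k n → numAvoidingInvolutions k n ≡ walks (λ _ → 1) k n 0
numAvoidingInvolutions≡walks k n = trans
  (↭-length (∼bag⇒↭ (unique∧set⇒bag
    (Unique.filter⁺ (avoidingInvolution? k) (words-unique n n))
    (goodInvolutions-unique k n 0 eq)
    (λ {α} → mk⇔ (λ α∈ → goodInvolutions-complete k n 0 eq
                   (AvoidingInvolution⇒Good α (proj₂ (∈-filter⁻ (avoidingInvolution? k) {xs = words n n} α∈))))
         (λ α∈ → ∈-filter⁺ (avoidingInvolution? k) (∈-words α)
                   (Good⇒AvoidingInvolution α (goodInvolutions-sound k n 0 eq α∈)))))))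
  (length-goodInvolutions k n 0 eq)
  where eq = ℕ.+-identityʳ n

-- Generating functions of walks in a strip

open import Data.Integer.Base using (+_)

walks-inside : ∀ w k m s → s ℕ.< k → walks w k m s ≡ walks⁺ w k m s
walks-inside w k m s s<k with s ℕ.<? k
... | yes _   = refl
... | no s≮k  = contradiction s<k s≮k

walks-outside : ∀ w k m → walks w k m k ≡ 0
walks-outside w k m with k ℕ.<? k
... | yes k<k = contradiction k<k (ℕ.<-irrefl refl)
... | no _    = refl

fromℕ-+ : ∀ a b → + (a ℕ.+ b) ℚ./ 1 ≡ + a ℚ./ 1 ℚ.+ + b ℚ./ 1
fromℕ-+ a b = ℚ.toℚᵘ-injective (begin
  ℚ.toℚᵘ (+ (a ℕ.+ b) ℚ./ 1)
    ≈⟨ ℚ.toℚᵘ-fromℚᵘ (mkℚᵘ (+ (a ℕ.+ b)) 0) ⟩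
  mkℚᵘ (+ (a ℕ.+ b)) 0
    ≈⟨ *≡* (cong (ℤ._* + 1) (cong₂ ℤ._+_ (ℤ.*-identityʳ (+ a)) (ℤ.*-identityʳ (+ b)))) ⟨
  mkℚᵘ (+ a) 0 ℚᵘ.+ mkℚᵘ (+ b) 0
    ≈⟨ ℚᵘ.+-cong (ℚ.toℚᵘ-fromℚᵘ (mkℚᵘ (+ a) 0)) (ℚ.toℚᵘ-fromℚᵘ (mkℚᵘ (+ b) 0)) ⟨
  ℚ.toℚᵘ (+ a ℚ./ 1) ℚᵘ.+ ℚ.toℚᵘ (+ b ℚ./ 1)
    ≈⟨ ℚ.toℚᵘ-homo-+ (+ a ℚ./ 1) (+ b ℚ./ 1) ⟨
  ℚ.toℚᵘ (+ a ℚ./ 1 ℚ.+ + b ℚ./ 1) ∎)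
  where open ℚᵘ.≃-Reasoning

module _ where
  open CommutativeRing LaurentLaws.laurentCommutativeRing
    using (Carrier; _≈_; _+_; _*_; -_; 0#; 1#; +-identityʳ)
  open LaurentLaws using (≃-sym; ≃-trans)
  open Chebyshev laurentRing

  X*1/X≈1 : X * ((1# + 1#) * 1/2X) ≈ 1#
  -- The left side has pole bound 1, so the equation to check is x · (2 · ½) = x.
  X*1/X≈1 n = trans (sym (shift-⊛ 1 twoHalves n)) (shifted n)
    where
    two = constant 1ℚ ⊞ constant 1ℚ
    twoHalves = two ⊛ constant ½
    twoHalves≐1 : twoHalves ≐ constant 1ℚ
    twoHalves≐1 n = trans (PowerSeriesLaws.⊛-comm two (constant ½) n)
      (trans (PowerSeriesLaws.constant-⊛ ½ two n) (lemma n))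
      where
      lemma : ∀ n → ½ ℚ.* two n ≡ constant 1ℚ n
      lemma zero    = refl
      lemma (suc n) = refl
    shifted : shift 1 twoHalves ≐ shift 1 (constant 1ℚ)
    shifted zero    = refl
    shifted (suc n) = twoHalves≐1 n

  constantSeries : ℕ → LaurentSeries
  constantSeries a = x⁻ 0 · constant (+ a ℚ./ 1)

  module _ (w : ℕ → ℕ) (k : ℕ) where

    walkSeries : ℕ → LaurentSeries
    walkSeries s = generatingFunction λ m → walks w k m s

    private
      coefficients : ℕ → PowerSeries
      coefficients s = LaurentSeries.series (walkSeries s)

    -- The constant coefficient is the weight of the empty walk; higher coefficients split off the
    -- first step, which from height 0 can only go up.
    walkSeries-zero : 0 ℕ.< k → walkSeries 0 ≈ constantSeries (w 0) + X * walkSeries 1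
    walkSeries-zero 0<k n = trans (step n)
      (cong (constant (+ w 0 ℚ./ 1) n ℚ.+_) (shift-⊛ 1 (coefficients 1) n))
      where
      step : ∀ n → coefficients 0 n ≡ constant (+ w 0 ℚ./ 1) n ℚ.+ shift 1 (coefficients 1) n
      step zero    rewrite walks-inside w k 0 0 0<k = sym (ℚ.+-identityʳ _)
      step (suc n) rewrite walks-inside w k (suc n) 0 0<k = sym (ℚ.+-identityˡ _)

    walkSeries-suc : ∀ s → suc s ℕ.< k →
      walkSeries (suc s) ≈ constantSeries (w (suc s)) + (X * walkSeries (suc (suc s)) + X * walkSeries s)
    walkSeries-suc s s<k n = trans (step n)
      (cong (constant (+ w (suc s) ℚ./ 1) n ℚ.+_)
        (cong₂ ℚ._+_ (shift-⊛ 1 (coefficients (suc (suc s))) n) (shift-⊛ 1 (coefficients s) n)))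
      where
      step : ∀ n → coefficients (suc s) n ≡ constant (+ w (suc s) ℚ./ 1) n ℚ.+
               (shift 1 (coefficients (suc (suc s))) n ℚ.+ shift 1 (coefficients s) n)
      step zero    rewrite walks-inside w k 0 (suc s) s<k = sym (ℚ.+-identityʳ _)
      step (suc n) rewrite walks-inside w k (suc n) (suc s) s<k =
        trans (fromℕ-+ (walks w k n (suc (suc s))) (walks w k n s)) (sym (ℚ.+-identityˡ _))

    walkSeries-outside : walkSeries k ≈ 0#
    walkSeries-outside n rewrite walks-outside w k n = sym (PowerSeriesLaws.constant-0 n)

  open TridiagonalSystem LaurentLaws.laurentCommutativeRing

  allWalks : ∀ k → walkSeries (λ _ → 1) k 0 * (X * U k 1/2X) ≈ ∑U X 1/2X X*1/X≈1 k
  allWalks k = F₀*xU-boundary X 1/2X X*1/X≈1 k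
    -- A walk may end at any height, so the source is 1 everywhere and the correction is the partial
    -- sum of the U_j.
    (walkSeries (λ _ → 1) k) (λ _ → 1#) (∑U X 1/2X X*1/X≈1)
    (walkSeries-zero _ k) (walkSeries-suc _ k) (λ _ → refl) (λ _ → +-identityʳ 1#) (λ s _ → ∑U-suc X 1/2X X*1/X≈1 s)
    (walkSeries-outside _ k)

  δ : ℕ → ℕ → ℕ
  δ zero    zero    = 1
  δ zero    (suc j) = 0
  δ (suc i) zero    = 0
  δ (suc i) (suc j) = δ i j

  δ-refl : ∀ i → δ i i ≡ 1
  δ-refl zero    = refl
  δ-refl (suc i) = δ-refl i

  δ-> : ∀ {i j} → j ℕ.< i → δ i j ≡ 0
  δ-> {suc i} {zero}  _         = refl
  δ-> {suc i} {suc j} (s≤s j<i) = δ-> j<i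

  -- With the source only at the top height k, the correction is the source moved up by one: it
  -- vanishes up to k and is 1 at k + 1. This exhibits an explicit inverse of x U_{k+1}.
  walksToTop : ∀ k → walkSeries (δ k) (suc k) 0 * (X * U (suc k) 1/2X) ≈ 1#
  walksToTop k = ≃-trans (walkSeries (δ k) (suc k) 0 * (X * U (suc k) 1/2X)) (T (suc k)) 1#
    (F₀*xU-boundary X 1/2X X*1/X≈1 (suc k) (walkSeries (δ k) (suc k)) (constantSeries ∘ δ k) T
      (walkSeries-zero _ (suc k)) (walkSeries-suc _ (suc k)) (λ _ → refl) (λ _ _ → refl) T-suc
      (walkSeries-outside _ (suc k)))
    (λ n → cong (λ a → shift 0 (constant (+ a ℚ./ 1)) n) (δ-refl k))
    where
    T : ℕ → Carrier
    T = constantSeries ∘ δ (suc k)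

    T≈0 : ∀ s → s ℕ.< suc k → T s ≈ 0#
    T≈0 s s<k+1 n = cong (λ a → constant (+ a ℚ./ 1) n) (δ-> s<k+1)

    d = (1# + 1#) * 1/2X

    -- The source at s + 1 computes to `T (suc (suc s))`, so the two remaining terms have to vanish.
    T-suc : ∀ s → suc s ℕ.< suc k → T (suc (suc s)) ≈ T (suc (suc s)) + (d * T (suc s) + - T s)
    T-suc s s+1<k+1 = ≃-sym (T (suc (suc s)) + (d * T (suc s) + - T s)) (T (suc (suc s)))
      (+-zeroes (T (suc s)) (T s) (T (suc (suc s))) d (T≈0 (suc s) s+1<k+1) (T≈0 s (ℕ.<⇒≤ s+1<k+1)))

-- Inverting x U_k and the quotient formula

open Defs using (_≈_; _*_; 1#; sum; U)
open import Algebra.Definitions _≈_ using (Invertible)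

theorem2p7 : ∀ (k : ℕ) → k ≥ 1 →
    Σ[ inv ∈ Invertible 1# _*_ (X * U k 1/2X) ]
      generatingFunction (numAvoidingInvolutions k)
        ≈ proj₁ inv * sum {k} (λ j → U (toℕ j) 1/2X)
theorem2p7 k@(suc k-1) _ =
    -- The inverse of x U_k is the series of walks from 0 to the top height k - 1.
    (walkSeries (δ k-1) k 0 , inverseˡ , inverseʳ)
  , ≃-trans (generatingFunction (numAvoidingInvolutions k)) (walkSeries (λ _ → 1) k 0) (inv * Us)
      (λ n → cong (λ a → + a ℚ./ 1) (numAvoidingInvolutions≡walks k n))
      (divide (walkSeries (λ _ → 1) k 0) (X * U k 1/2X) Us inv inverseˡ (allWalks k))
  where
  open LaurentLaws using (≃-trans; ⊗-comm; laurentCommutativeRing)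
  open TridiagonalSystem laurentCommutativeRing using (divide)
  inv = walkSeries (δ k-1) k 0
  Us = sum {k} λ j → U (toℕ j) 1/2X
  inverseˡ : inv * (X * U k 1/2X) ≈ 1#
  inverseˡ = walksToTop k-1
  inverseʳ : (X * U k 1/2X) * inv ≈ 1#
  inverseʳ = ≃-trans ((X * U k 1/2X) * inv) (inv * (X * U k 1/2X)) 1#
    (⊗-comm (X * U k 1/2X) inv) inverseˡ
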